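{- The rectilinear crossing number constant $q_*:=\lim_{n\to\infty}\overline{\mathrm{cr}}(K_n)/\binom{n}{4}$ satisfies $q_*\leq \frac{83247328}{218791125}<0.380488$.
   Context: $\overline{\mathrm{cr}}(K_n)$, the rectilinear crossing number of $K_n$, is the minimum, over all sets $P$ of $n$ points in general position in the plane, of the number of crossings in the complete graph on $P$ drawn with straight-line edges (equivalently, the number of $4$-subsets of $P$ in convex position). The limit defining $q_*$ exists. -}

module Defs where

open import Data.Bool using (Bool; true; false; if_then_else_; _∧_; _∨_; not)
open import Data.Nat as ℕ using (ℕ; suc; _≤_; _<_; _*_; _+_)
open import Data.Nat.Combinatorics using (_C_)
open import Data.Integer as ℤ using (ℤ; 0ℤ)
open import Data.Fin using (Fin; toℕ)
open import Data.List using (List; map; concatMap; allFin)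
open import Data.Nat.ListAction using (sum)
open import Data.Product using (_×_; _,_)
open import Relation.Nullary using (¬_; does)
open import Relation.Binary.PropositionalEquality using (_≡_)

Point : Set
Point = ℤ × ℤ

-- Orientation determinant of the triple (p, q, r):
-- (q - p) × (r - p); positive = counterclockwise, 0 = collinear.
orient : Point → Point → Point → ℤ
orient (px , py) (qx , qy) (rx , ry) =
  ((qx ℤ.- px) ℤ.* (ry ℤ.- py)) ℤ.- ((qy ℤ.- py) ℤ.* (rx ℤ.- px))

Config : ℕ → Set
Config n = Fin n → Point

GeneralPosition : ∀ {n} → Config n → Set
GeneralPosition {n} P =
  (∀ (i j : Fin n) → P i ≡ P j → i ≡ j) ×
  (∀ (i j k : Fin n) → ¬ i ≡ j → ¬ j ≡ k → ¬ i ≡ k → ¬ orient (P i) (P j) (P k) ≡ 0ℤ)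

pos : ℤ → Bool
pos x = does (0ℤ ℤ.<? x)

-- d lies in the (open) triangle abc (for points in general position).
inTriangle : Point → Point → Point → Point → Bool
inTriangle a b c d =
  let s₁ = pos (orient a b d) ; s₂ = pos (orient b c d) ; s₃ = pos (orient c a d)
  in (s₁ ∧ s₂ ∧ s₃) ∨ (not s₁ ∧ not s₂ ∧ not s₃)

-- Four points (in general position) are in convex position iff none of
-- them lies inside the triangle spanned by the other three.
convex4 : Point → Point → Point → Point → Bool
convex4 a b c d =
  not (inTriangle a b c d ∨ inTriangle a b d c ∨ inTriangle a c d b ∨ inTriangle b c d a)

ltᵇ : ∀ {n} → Fin n → Fin n → Bool
ltᵇ i j = does (toℕ i ℕ.<? toℕ j)

-- Number of crossings of the straight-line drawing of the complete graph on P,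
-- i.e. the number of 4-subsets {i<j<k<l} of P in convex position.
crossings : ∀ {n} → Config n → ℕ
crossings {n} P =
  sum (concatMap (λ i → concatMap (λ j → concatMap (λ k → map (λ l →
        if ltᵇ i j ∧ ltᵇ j k ∧ ltᵇ k l ∧ convex4 (P i) (P j) (P k) (P l)
        then 1 else 0)
      (allFin n)) (allFin n)) (allFin n)) (allFin n))

-- "cr̄(K_n) ≤ c": some n-point set in general position has at most c crossings
-- (cr̄(K_n) is the minimum of crossings over such sets).
crBar≤ : ℕ → ℕ → Set
crBar≤ n c = Σ (Config n) (λ P → GeneralPosition P × (crossings P ≤ c))
  where open import Data.Product using (Σ)

-- The bound  q* ≤ a/b  with a = 83247328, b = 218791125, in the form
-- (since the limit q* exists):  for every ε = 1/(m+1) there is N such that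
-- for all n ≥ N,  cr̄(K_n) / C(n,4) ≤ a/b + 1/(m+1),  i.e.
-- cr̄(K_n) · b · (m+1) ≤ (a·(m+1) + b) · C(n,4).
qStar≤ : ℕ → ℕ → Set
qStar≤ a b = ∀ (m : ℕ) → Σ ℕ (λ N → ∀ (n : ℕ) → N ≤ n →
  Σ ℕ (λ c → crBar≤ n c × (c * b * suc m ≤ (a * suc m + b) * (n C 4))))
  where open import Data.Product using (Σ)

{-# OPTIONS --safe #-}

-- A configuration is improved by blowing it up.  Let P have m points (m odd)
-- and let every point p lie on a line with h = (m - 1)/2 of the other points
-- on each side.  Replace p by a copy of a k-point set S, flattened along that
-- line and very small.  Writing L(i,j) for the number of points to the left of
-- the line ij, one has  2 cr + Σ L(i,j) L(j,i) = 6 C(n,4),  and in the blow-up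
-- the numbers L can be read off from P, S and the order of S along the line.
-- Hence  24 cr(blow-up) = D k⁴ + 24 m cr(S) + O(k³)  with
-- D = 24 cr(P) + 3 m (m - 1)(m - 3) + 5 m (m - 1),  and iterating gives
-- q* ≤ D / (m⁴ - m).  A 75-point set with 450510 crossings suffices.
module Submission where

open import Defs
open import Data.Bool using (Bool; true; false; if_then_else_; _∧_; _∨_; not) renaming (T to IsTrue)
open import Data.Empty using (⊥-elim)
open import Data.Fin using (Fin; zero; suc; toℕ; _≟_; combine; remQuot; inject≤; _↑ˡ_; _↑ʳ_)
import Data.Fin.Properties as Fin
open import Data.Fin.Properties using (remQuot-combine; combine-remQuot; inject≤-injective)
open import Data.Integer as ℤ using (ℤ; 0ℤ; -[1+_]; ∣_∣; +≤+; +<+)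
  renaming (_+_ to _+ᶻ_; _-_ to _-ᶻ_; _*_ to _*ᶻ_; -_ to -ᶻ_; +_ to ⁺_; _<_ to _<ᶻ_; _≤_ to _≤ᶻ_)
import Data.Integer.Properties as ℤₚ
import Data.Integer.Tactic.RingSolver as ℤ-Solver
open import Data.List using (List; tabulate; concatMap; map; allFin)
open import Data.Nat using (ℕ; zero; suc; _+_; _*_; _∸_; _/_; _%_; _≤_; _<_; z≤n; s≤s; s≤s⁻¹; _≡ᵇ_; >-nonZero)
open import Data.Nat.Combinatorics using (_C_; nC1≡n; nCk+nC[k+1]≡[n+1]C[k+1])
open import Data.Nat.DivMod using (m≡m%n+[m/n]*n; m/n<m; m%n<n)
open import Data.Nat.Induction using (<-rec)
import Data.Nat.ListAction as List
open import Data.Nat.ListAction.Properties using (sum-++)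
import Data.Nat.Properties as ℕ
open import Data.Nat.Tactic.RingSolver using (solve-∀)
open import Data.Product using (Σ; ∃; _×_; _,_; proj₁; proj₂; uncurry)
open import Data.Sum using (inj₁; inj₂)
open import Data.Vec using (Vec; []; _∷_; lookup)
open import Function using (_∘_; id)
open import Relation.Binary using (tri<; tri≈; tri>)
open import Relation.Binary.PropositionalEquality
  using (_≡_; _≢_; refl; sym; trans; cong; cong₂; subst; subst₂; module ≡-Reasoning)
open import Relation.Nullary using (¬_; Dec; yes; no; does)
open import Algebra.Properties.Semiring.Sum ℕ.+-*-semiring
  using (sum; sum-cong-≗; ∑-distrib-+; ∑-comm; *-distribˡ-sum; *-distribʳ-sum; sum-replicate-zero)

-- Why the lines should halve: two points of one cluster see k h points of the other clusters on
-- either side, so L(i,j) and L(j,i) both gain k h. The two gains have a fixed sum, so equal ones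
-- make the product largest, and a large Σ L(i,j) L(j,i) means few crossings. For two different
-- clusters the total of the products does not depend on how their lines run. The constant is a
-- fixed point: if 24 cr(S) is about x k⁴, the blow-up has D k⁴ + m x k⁴, and this equals x (m k)⁴
-- exactly for x = D / (m⁴ - m). Blowing up reaches only multiples of m. So for arbitrary n a good
-- set of ⌈n/75⌉ points is blown up and at most 74 points are deleted, which costs a term of order
-- n³. Coordinates are integers, so instead of shrinking the copies of S the set P is enlarged, by
-- explicit factors that exceed the sum of all error terms. The crossings of the base set are never
-- counted quadruple by quadruple: only Σ L(i,j) L(j,i) is evaluated, which takes cubically many
-- orientation tests.

private variable n : ℕ

-- Sums over increasing tuples

∑-zero : {f : Fin n → ℕ} → (∀ i → f i ≡ 0) → sum f ≡ 0
∑-zero {n} f≡0 = trans (sum-cong-≗ f≡0) (sum-replicate-zero n)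

-- sum₂, sum₃ and sum₄ range over strictly increasing tuples of indices.
sum₂ : (Fin n → Fin n → ℕ) → ℕ
sum₂ {zero}  f = 0
sum₂ {suc n} f = sum (λ j → f zero (suc j)) + sum₂ (λ i j → f (suc i) (suc j))

sum₃ : (Fin n → Fin n → Fin n → ℕ) → ℕ
sum₃ {zero}  f = 0
sum₃ {suc n} f = sum₂ (λ j k → f zero (suc j) (suc k)) + sum₃ (λ i j k → f (suc i) (suc j) (suc k))

sum₄ : (Fin n → Fin n → Fin n → Fin n → ℕ) → ℕ
sum₄ {zero}  f = 0
sum₄ {suc n} f = sum₃ (λ j k l → f zero (suc j) (suc k) (suc l))
  + sum₄ (λ i j k l → f (suc i) (suc j) (suc k) (suc l))

_<ᶠ_ : Fin n → Fin n → Set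
i <ᶠ j = toℕ i < toℕ j

sum₂-cong : {f g : Fin n → Fin n → ℕ} → (∀ i j → i <ᶠ j → f i j ≡ g i j) → sum₂ f ≡ sum₂ g
sum₂-cong {zero}  e = refl
sum₂-cong {suc n} e = cong₂ _+_ (sum-cong-≗ λ j → e zero (suc j) (s≤s z≤n))
  (sum₂-cong λ i j p → e (suc i) (suc j) (s≤s p))

sum₃-cong : {f g : Fin n → Fin n → Fin n → ℕ} →
  (∀ i j k → i <ᶠ j → j <ᶠ k → f i j k ≡ g i j k) → sum₃ f ≡ sum₃ g
sum₃-cong {zero}  e = refl
sum₃-cong {suc n} e = cong₂ _+_ (sum₂-cong λ j k p → e zero (suc j) (suc k) (s≤s z≤n) (s≤s p))
  (sum₃-cong λ i j k p q → e (suc i) (suc j) (suc k) (s≤s p) (s≤s q))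

sum₄-cong : {f g : Fin n → Fin n → Fin n → Fin n → ℕ} →
  (∀ i j k l → i <ᶠ j → j <ᶠ k → k <ᶠ l → f i j k l ≡ g i j k l) → sum₄ f ≡ sum₄ g
sum₄-cong {zero}  e = refl
sum₄-cong {suc n} e = cong₂ _+_
  (sum₃-cong λ j k l p q → e zero (suc j) (suc k) (suc l) (s≤s z≤n) (s≤s p) (s≤s q))
  (sum₄-cong λ i j k l p q r → e (suc i) (suc j) (suc k) (suc l) (s≤s p) (s≤s q) (s≤s r))

shuffle : ∀ a b c d → (a + b) + (c + d) ≡ (a + c) + (b + d)
shuffle = solve-∀

sum₂-+ : (f g : Fin n → Fin n → ℕ) → sum₂ (λ i j → f i j + g i j) ≡ sum₂ f + sum₂ g
sum₂-+ {zero}  f g = refl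
sum₂-+ {suc n} f g = trans
  (cong₂ _+_ (∑-distrib-+ (λ j → f zero (suc j)) (λ j → g zero (suc j)))
             (sum₂-+ (λ i j → f (suc i) (suc j)) (λ i j → g (suc i) (suc j))))
  (shuffle (sum (λ j → f zero (suc j))) _ _ _)

sum₃-+ : (f g : Fin n → Fin n → Fin n → ℕ) → sum₃ (λ i j k → f i j k + g i j k) ≡ sum₃ f + sum₃ g
sum₃-+ {zero}  f g = refl
sum₃-+ {suc n} f g = trans
  (cong₂ _+_ (sum₂-+ (λ j k → f zero (suc j) (suc k)) (λ j k → g zero (suc j) (suc k)))
             (sum₃-+ (λ i j k → f (suc i) (suc j) (suc k)) (λ i j k → g (suc i) (suc j) (suc k))))
  (shuffle (sum₂ (λ j k → f zero (suc j) (suc k))) _ _ _)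

sum₄-+ : (f g : Fin n → Fin n → Fin n → Fin n → ℕ) →
  sum₄ (λ i j k l → f i j k l + g i j k l) ≡ sum₄ f + sum₄ g
sum₄-+ {zero}  f g = refl
sum₄-+ {suc n} f g = trans
  (cong₂ _+_ (sum₃-+ (λ j k l → f zero (suc j) (suc k) (suc l)) (λ j k l → g zero (suc j) (suc k) (suc l)))
             (sum₄-+ (λ i j k l → f (suc i) (suc j) (suc k) (suc l)) (λ i j k l → g (suc i) (suc j) (suc k) (suc l))))
  (shuffle (sum₃ (λ j k l → f zero (suc j) (suc k) (suc l))) _ _ _)

-- The symmetrisation of a sum over all tuples into a sum over increasing
-- tuples is done one index at a time: the last index is inserted into the
-- increasing tuple formed by the others.
insert₂ : (f : Fin n → Fin n → ℕ) → (∀ i → f i i ≡ 0) →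
  sum (λ i → sum (f i)) ≡ sum₂ (λ i j → f i j + f j i)
insert₂ {zero}  f d = refl
insert₂ {suc n} f d = begin
  (f zero zero + a) + sum (λ i → f (suc i) zero + sum (λ j → f (suc i) (suc j)))
    ≡⟨ cong₂ _+_ (cong (_+ a) (d zero)) (∑-distrib-+ (λ i → f (suc i) zero) _) ⟩
  a + (b + sum (λ i → sum (λ j → f (suc i) (suc j))))
    ≡⟨ cong (λ z → a + (b + z)) (insert₂ (λ i j → f (suc i) (suc j)) (λ i → d (suc i))) ⟩
  a + (b + c)
    ≡⟨ ℕ.+-assoc a b c ⟨
  a + b + c
    ≡⟨ cong (_+ c) (∑-distrib-+ (λ j → f zero (suc j)) _) ⟨
  sum (λ j → f zero (suc j) + f (suc j) zero) + c ∎
  where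
  open ≡-Reasoning
  a = sum (λ j → f zero (suc j))
  b = sum (λ i → f (suc i) zero)
  c = sum₂ (λ i j → f (suc i) (suc j) + f (suc j) (suc i))

insert₃ : (f : Fin n → Fin n → Fin n → ℕ) → (∀ i j → f i j i ≡ 0) → (∀ i j → f i j j ≡ 0) →
  sum₂ (λ i j → sum (f i j)) ≡ sum₃ (λ i j k → f i j k + f i k j + f j k i)
insert₃ {zero}  f d e = refl
insert₃ {suc n} f d e = begin
  sum (λ j → f zero (suc j) zero + sum (λ k → f zero (suc j) (suc k)))
    + sum₂ (λ i j → f (suc i) (suc j) zero + sum (λ k → f (suc i) (suc j) (suc k)))
    ≡⟨ cong₂ _+_ (sum-cong-≗ λ j → cong (_+ sum (λ k → f zero (suc j) (suc k))) (d zero (suc j)))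
                 (sum₂-+ (λ i j → f (suc i) (suc j) zero) _) ⟩
  sum (λ j → sum (λ k → f zero (suc j) (suc k)))
    + (b + sum₂ (λ i j → sum (λ k → f (suc i) (suc j) (suc k))))
    ≡⟨ cong₂ (λ x y → x + (b + y)) (insert₂ (λ j k → f zero (suc j) (suc k)) (λ j → e zero (suc j)))
        (insert₃ (λ i j k → f (suc i) (suc j) (suc k)) (λ i j → d (suc i) (suc j)) (λ i j → e (suc i) (suc j))) ⟩
  a + (b + c)
    ≡⟨ ℕ.+-assoc a b c ⟨
  a + b + c
    ≡⟨ cong (_+ c) (sum₂-+ (λ j k → f zero (suc j) (suc k) + f zero (suc k) (suc j)) _) ⟨
  sum₂ (λ j k → f zero (suc j) (suc k) + f zero (suc k) (suc j) + f (suc j) (suc k) zero) + c ∎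
  where
  open ≡-Reasoning
  a = sum₂ (λ j k → f zero (suc j) (suc k) + f zero (suc k) (suc j))
  b = sum₂ (λ i j → f (suc i) (suc j) zero)
  c = sum₃ (λ i j k → f (suc i) (suc j) (suc k) + f (suc i) (suc k) (suc j) + f (suc j) (suc k) (suc i))

insert₄ : (f : Fin n → Fin n → Fin n → Fin n → ℕ) →
  (∀ i j k → f i j k i ≡ 0) → (∀ i j k → f i j k j ≡ 0) → (∀ i j k → f i j k k ≡ 0) →
  sum₃ (λ i j k → sum (f i j k)) ≡
  sum₄ (λ i j k l → f i j k l + f i j l k + f i k l j + f j k l i)
insert₄ {zero}  f d e g = refl
insert₄ {suc n} f d e g = begin
  sum₂ (λ j k → f zero (suc j) (suc k) zero + sum (λ l → f zero (suc j) (suc k) (suc l)))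
    + sum₃ (λ i j k → f (suc i) (suc j) (suc k) zero + sum (λ l → f (suc i) (suc j) (suc k) (suc l)))
    ≡⟨ cong₂ _+_ (sum₂-cong λ j k _ → cong (_+ sum (λ l → f zero (suc j) (suc k) (suc l))) (d zero (suc j) (suc k)))
                 (sum₃-+ (λ i j k → f (suc i) (suc j) (suc k) zero) _) ⟩
  sum₂ (λ j k → sum (λ l → f zero (suc j) (suc k) (suc l)))
    + (b + sum₃ (λ i j k → sum (λ l → f (suc i) (suc j) (suc k) (suc l))))
    ≡⟨ cong₂ (λ x y → x + (b + y))
        (insert₃ (λ j k l → f zero (suc j) (suc k) (suc l)) (λ j k → e zero (suc j) (suc k)) (λ j k → g zero (suc j) (suc k)))
        (insert₄ (λ i j k l → f (suc i) (suc j) (suc k) (suc l)) (λ i j k → d (suc i) (suc j) (suc k))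
          (λ i j k → e (suc i) (suc j) (suc k)) (λ i j k → g (suc i) (suc j) (suc k))) ⟩
  a + (b + c)
    ≡⟨ ℕ.+-assoc a b c ⟨
  a + b + c
    ≡⟨ cong (_+ c) (sum₃-+ (λ j k l → f zero (suc j) (suc k) (suc l) + f zero (suc j) (suc l) (suc k) + f zero (suc k) (suc l) (suc j)) _) ⟨
  sum₃ (λ j k l → f zero (suc j) (suc k) (suc l) + f zero (suc j) (suc l) (suc k) + f zero (suc k) (suc l) (suc j) + f (suc j) (suc k) (suc l) zero) + c ∎
  where
  open ≡-Reasoning
  a = sum₃ (λ j k l → f zero (suc j) (suc k) (suc l) + f zero (suc j) (suc l) (suc k) + f zero (suc k) (suc l) (suc j))
  b = sum₃ (λ i j k → f (suc i) (suc j) (suc k) zero)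
  c = sum₄ (λ i j k l → f (suc i) (suc j) (suc k) (suc l) + f (suc i) (suc j) (suc l) (suc k)
        + f (suc i) (suc k) (suc l) (suc j) + f (suc j) (suc k) (suc l) (suc i))

-- Crossings and separated pairs

ind : Bool → ℕ
ind b = if b then 1 else 0

listSum-concatMap : {A : Set} (f : A → List ℕ) (g : Fin n → A) →
  List.sum (concatMap f (tabulate g)) ≡ sum (λ i → List.sum (f (g i)))
listSum-concatMap {zero}  f g = refl
listSum-concatMap {suc n} f g = trans (sum-++ (f (g zero)) _)
  (cong (List.sum (f (g zero)) +_) (listSum-concatMap f (g ∘ suc)))

listSum-map : {A : Set} (f : A → ℕ) (g : Fin n → A) →
  List.sum (map f (tabulate g)) ≡ sum (λ i → f (g i))
listSum-map {zero}  f g = refl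
listSum-map {suc n} f g = cong (f (g zero) +_) (listSum-map f (g ∘ suc))

∑-if : ∀ b (f : Fin n → ℕ) → sum (λ i → if b then f i else 0) ≡ (if b then sum f else 0)
∑-if true  f = refl
∑-if {n} false f = ∑-zero {n} (λ _ → refl)

-- Almost by computation: `ltᵇ` reduces on `zero` and `suc`, so the row of `zero` keeps all entries
-- but the first and every other row loses its first entry.
sum₂-ordered : (f : Fin n → Fin n → ℕ) →
  sum (λ i → sum (λ j → if ltᵇ i j then f i j else 0)) ≡ sum₂ f
sum₂-ordered {zero}  f = refl
sum₂-ordered {suc n} f = cong (sum (λ j → f zero (suc j)) +_) (sum₂-ordered (λ i j → f (suc i) (suc j)))

sum₃-ordered : (f : Fin n → Fin n → Fin n → ℕ) →
  sum₂ (λ i j → sum (λ k → if ltᵇ j k then f i j k else 0)) ≡ sum₃ f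
sum₃-ordered {zero}  f = refl
sum₃-ordered {suc n} f = cong₂ _+_ (sum₂-ordered (λ j k → f zero (suc j) (suc k)))
  (sum₃-ordered (λ i j k → f (suc i) (suc j) (suc k)))

sum₄-ordered : (f : Fin n → Fin n → Fin n → Fin n → ℕ) →
  sum₃ (λ i j k → sum (λ l → if ltᵇ k l then f i j k l else 0)) ≡ sum₄ f
sum₄-ordered {zero}  f = refl
sum₄-ordered {suc n} f = cong₂ _+_ (sum₃-ordered (λ j k l → f zero (suc j) (suc k) (suc l)))
  (sum₄-ordered (λ i j k l → f (suc i) (suc j) (suc k) (suc l)))

ind-∧ : ∀ a b → ind (a ∧ b) ≡ (if a then ind b else 0)
ind-∧ true  b = refl
ind-∧ false b = refl

-- The conjunction in `crossings` is turned into nested conditionals, and each of the three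
-- `-ordered` lemmas consumes one of them to add one more increasing index.
crossings≡sum₄ : (P : Config n) → crossings P ≡ sum₄ (λ i j k l → ind (convex4 (P i) (P j) (P k) (P l)))
crossings≡sum₄ {n} P = begin
  crossings P
    ≡⟨ trans (listSum-concatMap listᵢ id) (sum-cong-≗ λ i →
       trans (listSum-concatMap (listⱼ i) id) (sum-cong-≗ λ j →
       trans (listSum-concatMap (listₖ i j) id) (sum-cong-≗ λ k → listSum-map (term i j k) id))) ⟩
  sum (λ i → sum (λ j → sum (λ k → sum (term i j k))))
    ≡⟨ (sum-cong-≗ λ i → sum-cong-≗ λ j → trans (sum-cong-≗ λ k → nest i j k) (∑-if (ltᵇ i j) (sumₖ i j))) ⟩
  sum (λ i → sum (λ j → if ltᵇ i j then sum (sumₖ i j) else 0))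
    ≡⟨ sum₂-ordered (λ i j → sum (sumₖ i j)) ⟩
  sum₂ (λ i j → sum (sumₖ i j))
    ≡⟨ sum₃-ordered (λ i j k → sum (sumₗ i j k)) ⟩
  sum₃ (λ i j k → sum (sumₗ i j k))
    ≡⟨ sum₄-ordered (λ i j k l → ind (c i j k l)) ⟩
  sum₄ (λ i j k l → ind (c i j k l)) ∎
  where
  open ≡-Reasoning
  c : Fin n → Fin n → Fin n → Fin n → Bool
  c i j k l = convex4 (P i) (P j) (P k) (P l)
  term : Fin n → Fin n → Fin n → Fin n → ℕ
  term i j k l = ind (ltᵇ i j ∧ ltᵇ j k ∧ ltᵇ k l ∧ c i j k l)
  listₖ : Fin n → Fin n → Fin n → List ℕ
  listₖ i j k = map (term i j k) (allFin n)
  listⱼ : Fin n → Fin n → List ℕ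
  listⱼ i j = concatMap (listₖ i j) (allFin n)
  listᵢ : Fin n → List ℕ
  listᵢ i = concatMap (listⱼ i) (allFin n)
  sumₗ : Fin n → Fin n → Fin n → Fin n → ℕ
  sumₗ i j k l = if ltᵇ k l then ind (c i j k l) else 0
  sumₖ : Fin n → Fin n → Fin n → ℕ
  sumₖ i j k = if ltᵇ j k then sum (sumₗ i j k) else 0
  nest : ∀ i j k → sum (term i j k) ≡ (if ltᵇ i j then sumₖ i j k else 0)
  nest i j k with ltᵇ i j | ltᵇ j k
  ... | false | _     = ∑-zero {n} (λ _ → refl)
  ... | true  | false = ∑-zero {n} (λ _ → refl)
  ... | true  | true  = sum-cong-≗ λ l → ind-∧ (ltᵇ k l) (c i j k l)

sum-1 : ∀ n → sum {n} (λ _ → 1) ≡ n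
sum-1 zero    = refl
sum-1 (suc n) = cong suc (sum-1 n)

sum₂-1 : ∀ n → sum₂ {n} (λ _ _ → 1) ≡ n C 2
sum₂-1 zero    = refl
sum₂-1 (suc n) = trans (cong₂ _+_ (trans (sum-1 n) (sym (nC1≡n n))) (sum₂-1 n)) (nCk+nC[k+1]≡[n+1]C[k+1] n 1)

sum₃-1 : ∀ n → sum₃ {n} (λ _ _ _ → 1) ≡ n C 3
sum₃-1 zero    = refl
sum₃-1 (suc n) = trans (cong₂ _+_ (sum₂-1 n) (sum₃-1 n)) (nCk+nC[k+1]≡[n+1]C[k+1] n 2)

sum₄-1 : ∀ n → sum₄ {n} (λ _ _ _ _ → 1) ≡ n C 4
sum₄-1 zero    = refl
sum₄-1 (suc n) = trans (cong₂ _+_ (sum₃-1 n) (sum₄-1 n)) (nCk+nC[k+1]≡[n+1]C[k+1] n 3)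

-- Orientations of triples, and the identity for four points

orient-rotate : ∀ a b c → orient a b c ≡ orient b c a
orient-rotate (ax , ay) (bx , by) (cx , cy) = lem ax ay bx by cx cy
  where
  lem : ∀ ax ay bx by cx cy →
    (bx -ᶻ ax) *ᶻ (cy -ᶻ ay) -ᶻ (by -ᶻ ay) *ᶻ (cx -ᶻ ax) ≡ (cx -ᶻ bx) *ᶻ (ay -ᶻ by) -ᶻ (cy -ᶻ by) *ᶻ (ax -ᶻ bx)
  lem = ℤ-Solver.solve-∀

orient-swap : ∀ a b c → orient b a c ≡ -ᶻ orient a b c
orient-swap (ax , ay) (bx , by) (cx , cy) = lem ax ay bx by cx cy
  where
  lem : ∀ ax ay bx by cx cy →
    (ax -ᶻ bx) *ᶻ (cy -ᶻ by) -ᶻ (ay -ᶻ by) *ᶻ (cx -ᶻ bx) ≡ -ᶻ ((bx -ᶻ ax) *ᶻ (cy -ᶻ ay) -ᶻ (by -ᶻ ay) *ᶻ (cx -ᶻ ax))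
  lem = ℤ-Solver.solve-∀

-- Both sides are twice the signed area of the quadrilateral abcd.
orient-area : ∀ a b c d → orient a b c +ᶻ orient a c d ≡ orient a b d +ᶻ orient b c d
orient-area (ax , ay) (bx , by) (cx , cy) (dx , dy) = lem ax ay bx by cx cy dx dy
  where
  lem : ∀ ax ay bx by cx cy dx dy →
    ((bx -ᶻ ax) *ᶻ (cy -ᶻ ay) -ᶻ (by -ᶻ ay) *ᶻ (cx -ᶻ ax)) +ᶻ ((cx -ᶻ ax) *ᶻ (dy -ᶻ ay) -ᶻ (cy -ᶻ ay) *ᶻ (dx -ᶻ ax)) ≡
    ((bx -ᶻ ax) *ᶻ (dy -ᶻ ay) -ᶻ (by -ᶻ ay) *ᶻ (dx -ᶻ ax)) +ᶻ ((cx -ᶻ bx) *ᶻ (dy -ᶻ by) -ᶻ (cy -ᶻ by) *ᶻ (dx -ᶻ bx))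
  lem = ℤ-Solver.solve-∀

orient-refl : ∀ a b → orient a a b ≡ 0ℤ
orient-refl (ax , ay) (bx , by) = lem ax ay bx by
  where
  lem : ∀ ax ay bx by → (ax -ᶻ ax) *ᶻ (by -ᶻ ay) -ᶻ (ay -ᶻ ay) *ᶻ (bx -ᶻ ax) ≡ 0ℤ
  lem = ℤ-Solver.solve-∀

pos-true : ∀ {x} → 0ℤ <ᶻ x → pos x ≡ true
pos-true {x} p with 0ℤ ℤ.<? x
... | yes _ = refl
... | no ¬p = ⊥-elim (¬p p)

pos-false : ∀ {x} → x ≤ᶻ 0ℤ → pos x ≡ false
pos-false {x} p with 0ℤ ℤ.<? x
... | yes q = ⊥-elim (ℤₚ.≤⇒≯ p q)
... | no _  = refl

pos-true⁻¹ : ∀ x → pos x ≡ true → 0ℤ <ᶻ x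
pos-true⁻¹ x e with 0ℤ ℤ.<? x
pos-true⁻¹ x e  | yes p = p
pos-true⁻¹ x () | no _

pos-false⁻¹ : ∀ x → pos x ≡ false → x ≤ᶻ 0ℤ
pos-false⁻¹ x e with 0ℤ ℤ.<? x
pos-false⁻¹ x () | yes _
pos-false⁻¹ x e  | no ¬p = ℤₚ.≮⇒≥ ¬p

pos-neg : ∀ x → x ≢ 0ℤ → pos (-ᶻ x) ≡ not (pos x)
pos-neg x x≢0 with pos x in e
... | true  = pos-false (ℤₚ.<⇒≤ (ℤₚ.neg-mono-< (pos-true⁻¹ x e)))
... | false = pos-true (ℤₚ.neg-mono-< (ℤₚ.≤∧≢⇒< (pos-false⁻¹ x e) x≢0))

left : Point → Point → Point → Bool
left a b c = pos (orient a b c)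

left-rotate : ∀ a b c → left a b c ≡ left b c a
left-rotate a b c = cong pos (orient-rotate a b c)

left-swap : ∀ a b c → orient a b c ≢ 0ℤ → left b a c ≡ not (left a b c)
left-swap a b c ne = trans (cong pos (orient-swap a b c)) (pos-neg (orient a b c) ne)

left-swap∧ : ∀ a b c → ind (left a b c) * ind (left b a c) ≡ 0
left-swap∧ a b c with left a b c in e
... | false = refl
... | true  = trans (ℕ.+-identityʳ _) (cong ind (trans (cong pos (orient-swap a b c))
                (pos-false (ℤₚ.<⇒≤ (ℤₚ.neg-mono-< (pos-true⁻¹ (orient a b c) e))))))

left-refl : ∀ a b → left a a b ≡ false
left-refl a b = cong pos (orient-refl a b)

-- Is 1 if the line ab strictly separates c from d, and 0 otherwise. The right side of ab is
-- expressed as the left side of ba, so that a point on the line belongs to neither side.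
splits : Point → Point → Point → Point → ℕ
splits a b c d = ind (left a b c) * ind (left b a d) + ind (left b a c) * ind (left a b d)

-- A truth table: the twenty equations reduce the orientations of all ordered triples to four
-- independent signs. Of the sixteen sign patterns the last hypothesis excludes two; in the other
-- fourteen both sides compute to 6.
fourPoints-count : ∀ {abc acb bac bca cab cba abd adb bad bda dab dba acd adc cad cda dac dca bcd bdc cbd cdb dbc dcb} →
  acb ≡ not abc → bac ≡ not abc → bca ≡ abc → cab ≡ abc → cba ≡ not abc → adb ≡ not abd → bad ≡ not abd → bda ≡ abd → dab ≡ abd → dba ≡ not abd → adc ≡ not acd → cad ≡ not acd → cda ≡ acd → dac ≡ acd → dca ≡ not acd → bdc ≡ not bcd → cbd ≡ not bcd → cdb ≡ bcd → dbc ≡ bcd → dcb ≡ not bcd →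
  (abc ≡ acd → abd ≡ bcd → abc ≡ abd) →
  2 * ind (not (((abd ∧ bcd ∧ cad) ∨ (not abd ∧ not bcd ∧ not cad)) ∨ ((abc ∧ bdc ∧ dac) ∨ (not abc ∧ not bdc ∧ not dac)) ∨ ((acb ∧ cdb ∧ dab) ∨ (not acb ∧ not cdb ∧ not dab)) ∨ ((bca ∧ cda ∧ dba) ∨ (not bca ∧ not cda ∧ not dba))))
    + 2 * ((ind abc * ind bad + ind bac * ind abd) + (ind acb * ind cad + ind cab * ind acd) + (ind bca * ind cbd + ind cba * ind bcd)
         + ((ind adb * ind dac + ind dab * ind adc) + (ind bda * ind dbc + ind dba * ind bdc) + (ind cda * ind dcb + ind dca * ind cdb))) ≡ 6
fourPoints-count {abc = true} {abd = true} {acd = true} {bcd = true} refl refl refl refl refl refl refl refl refl refl refl refl refl refl refl refl refl refl refl refl h = refl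
fourPoints-count {abc = true} {abd = true} {acd = true} {bcd = false} refl refl refl refl refl refl refl refl refl refl refl refl refl refl refl refl refl refl refl refl h = refl
fourPoints-count {abc = true} {abd = true} {acd = false} {bcd = true} refl refl refl refl refl refl refl refl refl refl refl refl refl refl refl refl refl refl refl refl h = refl
fourPoints-count {abc = true} {abd = true} {acd = false} {bcd = false} refl refl refl refl refl refl refl refl refl refl refl refl refl refl refl refl refl refl refl refl h = refl
fourPoints-count {abc = true} {abd = false} {acd = true} {bcd = true} refl refl refl refl refl refl refl refl refl refl refl refl refl refl refl refl refl refl refl refl h = refl
fourPoints-count {abc = true} {abd = false} {acd = true} {bcd = false} refl refl refl refl refl refl refl refl refl refl refl refl refl refl refl refl refl refl refl refl h with () ← h refl refl
fourPoints-count {abc = true} {abd = false} {acd = false} {bcd = true} refl refl refl refl refl refl refl refl refl refl refl refl refl refl refl refl refl refl refl refl h = refl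
fourPoints-count {abc = true} {abd = false} {acd = false} {bcd = false} refl refl refl refl refl refl refl refl refl refl refl refl refl refl refl refl refl refl refl refl h = refl
fourPoints-count {abc = false} {abd = true} {acd = true} {bcd = true} refl refl refl refl refl refl refl refl refl refl refl refl refl refl refl refl refl refl refl refl h = refl
fourPoints-count {abc = false} {abd = true} {acd = true} {bcd = false} refl refl refl refl refl refl refl refl refl refl refl refl refl refl refl refl refl refl refl refl h = refl
fourPoints-count {abc = false} {abd = true} {acd = false} {bcd = true} refl refl refl refl refl refl refl refl refl refl refl refl refl refl refl refl refl refl refl refl h with () ← h refl refl
fourPoints-count {abc = false} {abd = true} {acd = false} {bcd = false} refl refl refl refl refl refl refl refl refl refl refl refl refl refl refl refl refl refl refl refl h = refl
fourPoints-count {abc = false} {abd = false} {acd = true} {bcd = true} refl refl refl refl refl refl refl refl refl refl refl refl refl refl refl refl refl refl refl refl h = refl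
fourPoints-count {abc = false} {abd = false} {acd = true} {bcd = false} refl refl refl refl refl refl refl refl refl refl refl refl refl refl refl refl refl refl refl refl h = refl
fourPoints-count {abc = false} {abd = false} {acd = false} {bcd = true} refl refl refl refl refl refl refl refl refl refl refl refl refl refl refl refl refl refl refl refl h = refl
fourPoints-count {abc = false} {abd = false} {acd = false} {bcd = false} refl refl refl refl refl refl refl refl refl refl refl refl refl refl refl refl refl refl refl refl h = refl

module FourPoints (a b c d : Point)
  (abc≢0 : orient a b c ≢ 0ℤ) (abd≢0 : orient a b d ≢ 0ℤ)
  (acd≢0 : orient a c d ≢ 0ℤ) (bcd≢0 : orient b c d ≢ 0ℤ) where

  module Triple (x y z : Point) (ne : orient x y z ≢ 0ℤ) where
    yzx : left y z x ≡ left x y z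
    yzx = sym (left-rotate x y z)
    zxy : left z x y ≡ left x y z
    zxy = left-rotate z x y
    yxz : left y x z ≡ not (left x y z)
    yxz = left-swap x y z ne
    xzy : left x z y ≡ not (left x y z)
    xzy = trans (left-rotate x z y) (trans (left-rotate z y x) yxz)
    zyx : left z y x ≡ not (left x y z)
    zyx = trans (left-rotate z y x) yxz

  module ABC = Triple a b c abc≢0
  module ABD = Triple a b d abd≢0
  module ACD = Triple a c d acd≢0
  module BCD = Triple b c d bcd≢0

  -- In the two forbidden patterns `orient-area` would equate a sum of two positive determinants
  -- with a sum of two nonpositive ones.
  realizable : (left a b c ≡ left a c d → left a b d ≡ left b c d → left a b c ≡ left a b d)
  realizable e₁ e₂ with left a b c in abc | left a c d in acd | left a b d in abd | left b c d in bcd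
  ... | true  | true  | true  | true  = refl
  ... | false | false | false | false = refl
  ... | true  | true  | false | false = ⊥-elim (ℤₚ.<⇒≱ (ℤₚ.+-mono-< (pos-true⁻¹ (orient a b c) abc) (pos-true⁻¹ (orient a c d) acd))
          (subst (_≤ᶻ 0ℤ) (sym (orient-area a b c d)) (ℤₚ.+-mono-≤ (pos-false⁻¹ (orient a b d) abd) (pos-false⁻¹ (orient b c d) bcd))))
  ... | false | false | true  | true  = ⊥-elim (ℤₚ.<⇒≱ (ℤₚ.+-mono-< (pos-true⁻¹ (orient a b d) abd) (pos-true⁻¹ (orient b c d) bcd))
          (subst (_≤ᶻ 0ℤ) (orient-area a b c d) (ℤₚ.+-mono-≤ (pos-false⁻¹ (orient a b c) abc) (pos-false⁻¹ (orient a c d) acd))))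

  -- Two of the six edges separate the other two points in convex position,
  -- and three of them otherwise.
  convex+splits : 2 * ind (convex4 a b c d)
    + 2 * (splits a b c d + splits a c b d + splits b c a d
         + (splits a d b c + splits b d a c + splits c d a b)) ≡ 6
  convex+splits = fourPoints-count
    ABC.xzy ABC.yxz ABC.yzx ABC.zxy ABC.zyx ABD.xzy ABD.yxz ABD.yzx ABD.zxy ABD.zyx ACD.xzy ACD.yxz ACD.yzx ACD.zxy ACD.zyx BCD.xzy BCD.yxz BCD.yzx BCD.zxy BCD.zyx
    realizable

sum₄-* : ∀ c (f : Fin n → Fin n → Fin n → Fin n → ℕ) → sum₄ (λ i j k l → suc c * f i j k l) ≡ suc c * sum₄ f
sum₄-* zero    f = trans (sum₄-cong λ i j k l _ _ _ → ℕ.+-identityʳ (f i j k l)) (sym (ℕ.+-identityʳ (sum₄ f)))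
sum₄-* (suc c) f = trans (sum₄-+ f (λ i j k l → suc c * f i j k l)) (cong (sum₄ f +_) (sum₄-* c f))

∑-* : {m : ℕ} (f : Fin m → ℕ) (g : Fin n → ℕ) → sum f * sum g ≡ sum (λ i → sum (λ j → f i * g j))
∑-* f g = trans (*-distribʳ-sum (sum g) f) (sum-cong-≗ λ i → *-distribˡ-sum (f i) g)

left-aba : ∀ a b → left a b a ≡ false
left-aba a b = trans (sym (left-rotate a a b)) (left-refl a b)

left-abb : ∀ a b → left a b b ≡ false
left-abb a b = trans (left-rotate a b b) (left-refl b a)

lefts : Config n → Fin n → Fin n → ℕ
lefts P i j = sum (λ k → ind (left (P i) (P j) (P k)))

-- Each product counts the pairs of points separated by the line ij. The sum runs over ordered
-- pairs, so every edge counts twice: a quadruple contributes 4 in convex position and 6 otherwise.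
separations : Config n → ℕ
separations P = sum (λ i → sum (λ j → lefts P i j * lefts P j i))

splits-comm : ∀ a b c d → splits a b d c ≡ splits a b c d
splits-comm a b c d = lem (ind (left a b d)) (ind (left b a c)) (ind (left b a d)) (ind (left a b c))
  where
  lem : ∀ w x y z → w * x + y * z ≡ z * y + x * w
  lem = solve-∀

splits-abad : ∀ a b d → splits a b a d ≡ 0
splits-abad a b d = cong₂ (λ x y → ind x * ind (left b a d) + ind y * ind (left a b d)) (left-aba a b) (left-abb b a)

splits-abbd : ∀ a b d → splits a b b d ≡ 0
splits-abbd a b d = cong₂ (λ x y → ind x * ind (left b a d) + ind y * ind (left a b d)) (left-abb a b) (left-aba b a)

splits-abcc : ∀ a b c → splits a b c c ≡ 0
splits-abcc a b c = cong₂ _+_ (left-swap∧ a b c) (left-swap∧ b a c)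

module Symmetrise {n} (S : Fin n → Fin n → Fin n → Fin n → ℕ)
  (S-comm : ∀ i j k l → S i j l k ≡ S i j k l)
  (S-iji : ∀ i j l → S i j i l ≡ 0) (S-ijj : ∀ i j l → S i j j l ≡ 0) (S-ijkk : ∀ i j k → S i j k k ≡ 0) where

  private
    h : Fin n → Fin n → Fin n → ℕ
    h i j k = sum (S i j k)

    u : Fin n → Fin n → Fin n → Fin n → ℕ
    u i j k l = S i j k l + S i k j l + S j k i l

  sixPairs : Fin n → Fin n → Fin n → Fin n → ℕ
  sixPairs i j k l = S i j k l + S i k j l + S j k i l + (S i l j k + S j l i k + S k l i j)

  private
    hhh≡u : ∀ i j k → h i j k + h i k j + h j k i ≡ sum (u i j k)
    hhh≡u i j k = trans (cong (_+ h j k i) (sym (∑-distrib-+ (S i j k) (S i k j))))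
      (sym (∑-distrib-+ (λ l → S i j k l + S i k j l) (S j k i)))

    uuuu≡2v : ∀ i j k l → u i j k l + u i j l k + u i k l j + u j k l i ≡ 2 * sixPairs i j k l
    uuuu≡2v i j k l
      rewrite S-comm i j k l | S-comm i k j l | S-comm i l j k | S-comm j k i l | S-comm j l i k | S-comm k l i j
      = lem (S i j k l) (S i k j l) (S j k i l) (S i l j k) (S j l i k) (S k l i j)
      where
      lem : ∀ a b c d e f → (a + b + c) + (a + d + e) + (b + d + f) + (c + e + f) ≡ 2 * (a + b + c + (d + e + f))
      lem = solve-∀

    u-i : ∀ i j k → u i j k i ≡ 0
    u-i i j k rewrite S-comm i j i k | S-comm i k i j | S-iji i j k | S-iji i k j = S-ijkk j k i
    u-j : ∀ i j k → u i j k j ≡ 0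
    u-j i j k rewrite S-comm i j j k | S-comm j k j i | S-ijj i j k | S-iji j k i | S-ijkk i k j = refl
    u-k : ∀ i j k → u i j k k ≡ 0
    u-k i j k rewrite S-comm i k k j | S-comm j k k i | S-ijj i k j | S-ijj j k i | S-ijkk i j k = refl

  -- A quadruple is met once for each of its six edges and each order of the two remaining points,
  -- and `S` does not see that order; hence the factor 2. Tuples with a repeated index contribute
  -- nothing.
  sum₂≡sum₄ : sum₂ (λ i j → sum (λ k → sum (S i j k))) ≡ sum₄ (λ i j k l → 2 * sixPairs i j k l)
  sum₂≡sum₄ = begin
    sum₂ (λ i j → sum (h i j))
      ≡⟨ insert₃ h (λ i j → ∑-zero {n} (S-iji i j)) (λ i j → ∑-zero {n} (S-ijj i j)) ⟩
    sum₃ (λ i j k → h i j k + h i k j + h j k i)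
      ≡⟨ sum₃-cong (λ i j k _ _ → hhh≡u i j k) ⟩
    sum₃ (λ i j k → sum (u i j k))
      ≡⟨ insert₄ u u-i u-j u-k ⟩
    sum₄ (λ i j k l → u i j k l + u i j l k + u i k l j + u j k l i)
      ≡⟨ sum₄-cong (λ i j k l _ _ _ → uuuu≡2v i j k l) ⟩
    sum₄ (λ i j k l → 2 * sixPairs i j k l) ∎
    where open ≡-Reasoning

module _ {n} (P : Config n) where
  private
    S : Fin n → Fin n → Fin n → Fin n → ℕ
    S i j k l = splits (P i) (P j) (P k) (P l)

    g : Fin n → Fin n → ℕ
    g i j = lefts P i j * lefts P j i

    open Symmetrise S (λ i j k l → splits-comm (P i) (P j) (P k) (P l))
      (λ i j l → splits-abad (P i) (P j) (P l)) (λ i j l → splits-abbd (P i) (P j) (P l))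
      (λ i j k → splits-abcc (P i) (P j) (P k))

    lefts-ii : ∀ i → lefts P i i ≡ 0
    lefts-ii i = ∑-zero {n} (λ k → cong ind (left-refl (P i) (P k)))

    gg≡h : ∀ i j → g i j + g j i ≡ sum (λ k → sum (S i j k))
    gg≡h i j = begin
      g i j + g j i
        ≡⟨ cong₂ _+_ (∑-* (λ k → ind (left (P i) (P j) (P k))) (λ l → ind (left (P j) (P i) (P l))))
                     (∑-* (λ k → ind (left (P j) (P i) (P k))) (λ l → ind (left (P i) (P j) (P l)))) ⟩
      sum (λ k → sum (a k)) + sum (λ k → sum (b k))
        ≡⟨ ∑-distrib-+ (λ k → sum (a k)) (λ k → sum (b k)) ⟨
      sum (λ k → sum (a k) + sum (b k))
        ≡⟨ sum-cong-≗ (λ k → ∑-distrib-+ (a k) (b k)) ⟨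
      sum (λ k → sum (S i j k)) ∎
      where
      open ≡-Reasoning
      a b : Fin n → Fin n → ℕ
      a k l = ind (left (P i) (P j) (P k)) * ind (left (P j) (P i) (P l))
      b k l = ind (left (P j) (P i) (P k)) * ind (left (P i) (P j) (P l))

  separations≡sum₄ : separations P ≡ sum₄ (λ i j k l → 2 * sixPairs i j k l)
  separations≡sum₄ = begin
    separations P
      ≡⟨ insert₂ g (λ i → cong (_* lefts P i i) (lefts-ii i)) ⟩
    sum₂ (λ i j → g i j + g j i)
      ≡⟨ sum₂-cong (λ i j _ → gg≡h i j) ⟩
    sum₂ (λ i j → sum (λ k → sum (S i j k)))
      ≡⟨ sum₂≡sum₄ ⟩
    sum₄ (λ i j k l → 2 * sixPairs i j k l) ∎
    where open ≡-Reasoning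

  private
    c : Fin n → Fin n → Fin n → Fin n → ℕ
    c i j k l = ind (convex4 (P i) (P j) (P k) (P l))

    ≢-of-< : ∀ {i j : Fin n} → i <ᶠ j → ¬ i ≡ j
    ≢-of-< i<j refl = ℕ.<-irrefl refl i<j

    module _ (noncollinear : ∀ (i j k : Fin n) → ¬ i ≡ j → ¬ j ≡ k → ¬ i ≡ k → ¬ orient (P i) (P j) (P k) ≡ 0ℤ) where

      triple : ∀ i j k → i <ᶠ j → j <ᶠ k → orient (P i) (P j) (P k) ≢ 0ℤ
      triple i j k p q = noncollinear i j k (≢-of-< p) (≢-of-< q) (≢-of-< (ℕ.<-trans p q))

      count : ∀ i j k l → i <ᶠ j → j <ᶠ k → k <ᶠ l → 2 * c i j k l + 2 * sixPairs i j k l ≡ 6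
      count i j k l p q r = FourPoints.convex+splits (P i) (P j) (P k) (P l)
        (triple i j k p q) (triple i j l p (ℕ.<-trans q r))
        (triple i k l (ℕ.<-trans p q) r) (triple j k l q r)

  -- This is `convex+splits` summed over all increasing quadruples. It trades crossings for a sum
  -- over pairs, which can be followed through a blow-up.
  crossings-separations : GeneralPosition P → 2 * crossings P + separations P ≡ 6 * (n C 4)
  crossings-separations (_ , noncollinear) = begin
    2 * crossings P + separations P
      ≡⟨ cong₂ _+_ (cong (2 *_) (crossings≡sum₄ P)) separations≡sum₄ ⟩
    2 * sum₄ c + sum₄ (λ i j k l → 2 * sixPairs i j k l)
      ≡⟨ cong (_+ sum₄ (λ i j k l → 2 * sixPairs i j k l)) (sum₄-* 1 c) ⟨
    sum₄ (λ i j k l → 2 * c i j k l) + sum₄ (λ i j k l → 2 * sixPairs i j k l)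
      ≡⟨ sum₄-+ (λ i j k l → 2 * c i j k l) (λ i j k l → 2 * sixPairs i j k l) ⟨
    sum₄ (λ i j k l → 2 * c i j k l + 2 * sixPairs i j k l)
      ≡⟨ sum₄-cong (count noncollinear) ⟩
    sum₄ {n} (λ i j k l → 6 * 1)
      ≡⟨ sum₄-* 5 (λ (i j k l : Fin n) → 1) ⟩
    6 * sum₄ {n} (λ i j k l → 1)
      ≡⟨ cong (6 *_) (sum₄-1 n) ⟩
    6 * (n C 4) ∎
    where open ≡-Reasoning

-- Counting in a blow-up

δ : Fin n → Fin n → ℕ
δ i j = if does (i ≟ j) then 1 else 0

∑-δ : (i : Fin n) (f : Fin n → ℕ) → sum (λ j → δ i j * f j) ≡ f i
∑-δ {suc n} zero    f = trans (cong₂ _+_ (ℕ.+-identityʳ (f zero)) (∑-zero {n} (λ _ → refl))) (ℕ.+-identityʳ (f zero))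
∑-δ {suc n} (suc i) f = trans (sum-cong-≗ (λ j → cong (_* f (suc j)) (δ-suc i j))) (∑-δ i (λ j → f (suc j)))
  where
  δ-suc : ∀ {n} (i j : Fin n) → δ (suc i) (suc j) ≡ δ i j
  δ-suc i j with i ≟ j
  ... | yes _ = refl
  ... | no _  = refl

∑-const : ∀ n c → sum {n} (λ _ → c) ≡ n * c
∑-const zero    c = refl
∑-const (suc n) c = cong (c +_) (∑-const n c)

ind-not : ∀ b → ind b + ind (not b) ≡ 1
ind-not true  = refl
ind-not false = refl

module StrictTotalOrder {k} (lt : Fin k → Fin k → Bool)
  (lt-irrefl : ∀ s → lt s s ≡ false)
  (lt-connex : ∀ {s t} → s ≢ t → lt t s ≡ not (lt s t))
  (lt-trans : ∀ s t u → lt s t ≡ true → lt t u ≡ true → lt s u ≡ true) where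

  below above : Fin k → ℕ
  below s = sum (λ u → ind (lt u s))
  above s = sum (λ u → ind (lt s u))

  distinct : Fin k → Fin k → ℕ
  distinct s t = ind (lt s t) + ind (lt t s)

  distinct-≢ : ∀ {s t} → s ≢ t → distinct s t ≡ 1
  distinct-≢ {s} {t} s≢t = trans (cong (λ b → ind (lt s t) + ind b) (lt-connex s≢t)) (ind-not (lt s t))

  distinct-refl : ∀ s → distinct s s ≡ 0
  distinct-refl s = cong (λ b → ind b + ind b) (lt-irrefl s)

  <ᶠ⇒≢ : {s t : Fin k} → s <ᶠ t → s ≢ t
  <ᶠ⇒≢ p refl = ℕ.<-irrefl refl p

  ∑-above : sum above ≡ k C 2
  ∑-above = trans (insert₂ (λ s t → ind (lt s t)) (λ s → cong ind (lt-irrefl s)))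
    (trans (sum₂-cong λ s t s<t → distinct-≢ (<ᶠ⇒≢ s<t)) (sum₂-1 k))

  ∑-below : sum below ≡ k C 2
  ∑-below = trans (∑-comm (λ s u → ind (lt u s))) ∑-above

  ∑-distinct : sum (λ s → sum (distinct s)) ≡ 2 * (k C 2)
  ∑-distinct = begin
    sum (λ s → sum (distinct s))
      ≡⟨ sum-cong-≗ (λ s → ∑-distrib-+ (λ t → ind (lt s t)) (λ t → ind (lt t s))) ⟩
    sum (λ s → above s + below s)
      ≡⟨ ∑-distrib-+ above below ⟩
    sum above + sum below
      ≡⟨ cong₂ _+_ ∑-above ∑-below ⟩
    k C 2 + k C 2
      ≡⟨ cong (k C 2 +_) (ℕ.+-identityʳ (k C 2)) ⟨
    2 * (k C 2) ∎
    where open ≡-Reasoning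

  private
    f : Fin k → Fin k → Fin k → ℕ
    f s u w = ind (lt u s) * ind (lt s w)

    g : Fin k → Fin k → Fin k → ℕ
    g s u w = f s u w + f u s w

    f-ssw : ∀ s w → f s s w ≡ 0
    f-ssw s w = cong (λ b → ind b * ind (lt s w)) (lt-irrefl s)

    f-sus : ∀ s u → f s u s ≡ 0
    f-sus s u = trans (cong (λ b → ind (lt u s) * ind b) (lt-irrefl s)) (ℕ.*-zeroʳ (ind (lt u s)))

    f-suu : ∀ s u → s ≢ u → f s u u ≡ 0
    f-suu s u s≢u rewrite lt-connex s≢u with lt s u
    ... | true  = refl
    ... | false = refl

    f-suu′ : ∀ s u → f s u u ≡ 0
    f-suu′ s u with s ≟ u
    ... | yes refl = f-ssw s s
    ... | no s≢u   = f-suu s u s≢u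

    -- The six terms are the six arrangements of a, b, c, and exactly one of them is increasing. The
    -- two cyclic outcomes of the comparisons are excluded by transitivity.
    six : ∀ {a b c : Fin k} → a ≢ b → b ≢ c → a ≢ c → g a b c + g a c b + g b c a ≡ 1
    six {a} {b} {c} a≢b b≢c a≢c
      rewrite lt-connex a≢b | lt-connex b≢c | lt-connex a≢c
      with lt a b in ab | lt b c in bc | lt a c in ac
    ... | true  | true  | true  = refl
    ... | true  | false | true  = refl
    ... | true  | false | false = refl
    ... | false | true  | true  = refl
    ... | false | true  | false = refl
    ... | false | false | false = refl
    ... | true  | true  | false with () ← trans (sym ac) (lt-trans a b c ab bc)
    ... | false | false | true  with () ← trans (sym bc) (lt-trans b a c (trans (lt-connex a≢b) (cong not ab)) ac)

  -- Each three-element subset is counted once, at its middle element.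
  ∑-below*above : sum (λ s → below s * above s) ≡ k C 3
  ∑-below*above = begin
    sum (λ s → below s * above s)
      ≡⟨ sum-cong-≗ (λ s → ∑-* (λ u → ind (lt u s)) (λ w → ind (lt s w))) ⟩
    sum (λ s → sum (λ u → sum (f s u)))
      ≡⟨ insert₂ (λ s u → sum (f s u)) (λ s → ∑-zero {k} (f-ssw s)) ⟩
    sum₂ (λ s u → sum (f s u) + sum (f u s))
      ≡⟨ sum₂-cong (λ s u _ → sym (∑-distrib-+ (f s u) (f u s))) ⟩
    sum₂ (λ s u → sum (g s u))
      ≡⟨ insert₃ g (λ s u → cong₂ _+_ (f-sus s u) (f-suu′ u s)) (λ s u → cong₂ _+_ (f-suu′ s u) (f-sus u s)) ⟩
    sum₃ (λ a b c → g a b c + g a c b + g b c a)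
      ≡⟨ sum₃-cong (λ a b c p q → six (<ᶠ⇒≢ p) (<ᶠ⇒≢ q) (<ᶠ⇒≢ (ℕ.<-trans p q))) ⟩
    sum₃ {k} (λ _ _ _ → 1)
      ≡⟨ sum₃-1 k ⟩
    k C 3 ∎
    where open ≡-Reasoning

∑-↑ : ∀ a {b} (f : Fin (a + b) → ℕ) → sum f ≡ sum {a} (λ i → f (i ↑ˡ b)) + sum {b} (λ j → f (a ↑ʳ j))
∑-↑ zero    f = refl
∑-↑ (suc a) {b} f = trans (cong (f zero +_) (∑-↑ a (λ i → f (suc i))))
  (sym (ℕ.+-assoc (f zero) (sum {a} (λ i → f (suc i ↑ˡ b))) (sum {b} (λ j → f (suc a ↑ʳ j)))))

∑-combine : ∀ m {k} (f : Fin (m * k) → ℕ) → sum f ≡ sum {m} (λ p → sum {k} (λ s → f (combine p s)))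
∑-combine zero        f = refl
∑-combine (suc m) {k} f = begin
  sum f
    ≡⟨ ∑-↑ k {m * k} f ⟩
  sum {k} (λ s → f (s ↑ˡ (m * k))) + sum {m * k} (λ i → f (k ↑ʳ i))
    ≡⟨ cong (sum {k} (λ s → f (s ↑ˡ (m * k))) +_) (∑-combine m {k} (λ i → f (k ↑ʳ i))) ⟩
  sum {suc m} (λ p → sum {k} (λ s → f (combine p s))) ∎
  where open ≡-Reasoning

∑-linear : ∀ c (f g : Fin n → ℕ) → sum (λ i → c * f i + g i) ≡ c * sum f + sum g
∑-linear {n} c f g = trans (∑-distrib-+ {n} (λ i → c * f i) g) (cong (_+ sum g) (sym (*-distribˡ-sum {n} c f)))

∑-product : ∀ c e (y y′ : Fin n → ℕ) →
  sum (λ t → (c + y t) * (e + y′ t)) ≡ n * (c * e) + c * sum y′ + e * sum y + sum (λ t → y t * y′ t)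
∑-product {n} c e y y′ = begin
  sum (λ t → (c + y t) * (e + y′ t))
    ≡⟨ sum-cong-≗ (λ t → expand c e (y t) (y′ t)) ⟩
  sum (λ t → c * y′ t + (e * y t + (c * e + y t * y′ t)))
    ≡⟨ trans (∑-linear c y′ _) (cong (c * sum y′ +_) (trans (∑-linear e y _)
         (cong (e * sum y +_) (trans (∑-distrib-+ (λ _ → c * e) (λ t → y t * y′ t))
         (cong (_+ sum (λ t → y t * y′ t)) (∑-const n (c * e))))))) ⟩
  c * sum y′ + (e * sum y + (n * (c * e) + sum (λ t → y t * y′ t)))
    ≡⟨ collect (c * sum y′) (e * sum y) (n * (c * e)) (sum (λ t → y t * y′ t)) ⟩
  n * (c * e) + c * sum y′ + e * sum y + sum (λ t → y t * y′ t) ∎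
  where
  open ≡-Reasoning
  expand : ∀ c e y y′ → (c + y) * (e + y′) ≡ c * y′ + (e * y + (c * e + y * y′))
  expand = solve-∀
  collect : ∀ a b c d → a + (b + (c + d)) ≡ c + a + b + d
  collect = solve-∀

-- Only the sums of the four functions and of x x′ and y y′ enter the result. For two clusters these
-- are the same whichever way the flattened copies point.
∑∑-product : ∀ {k} a b G T (x x′ y y′ : Fin k → ℕ) →
  sum x ≡ G → sum x′ ≡ G → sum y ≡ G → sum y′ ≡ G →
  sum (λ s → x s * x′ s) ≡ T → sum (λ t → y t * y′ t) ≡ T →
  sum (λ s → sum (λ t → (a + x s + y t) * (b + x′ s + y′ t))) ≡
  k * k * (a * b) + (a + b) * (2 * k * G) + (2 * k * T + 2 * G * G)
∑∑-product {k} a b G T x x′ y y′ ∑x ∑x′ ∑y ∑y′ ∑xx′ ∑yy′ = begin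
  sum (λ s → sum (λ t → (a + x s + y t) * (b + x′ s + y′ t)))
    ≡⟨ sum-cong-≗ (λ s → trans (∑-product (a + x s) (b + x′ s) y y′)
         (trans (cong₂ (λ g h → k * ((a + x s) * (b + x′ s)) + (a + x s) * g + (b + x′ s) * h + sum (λ t → y t * y′ t)) ∑y′ ∑y)
         (trans (cong (k * ((a + x s) * (b + x′ s)) + (a + x s) * G + (b + x′ s) * G +_) ∑yy′)
           (regroup k (a + x s) (b + x′ s) a b G T (x s) (x′ s))))) ⟩
  sum (λ s → k * ((a + x s) * (b + x′ s)) + (G * x s + (G * x′ s + (a * G + b * G + T))))
    ≡⟨ trans (∑-linear k (λ s → (a + x s) * (b + x′ s)) _) (cong (k * sum (λ s → (a + x s) * (b + x′ s)) +_)
         (trans (∑-linear G x _) (cong (G * sum x +_) (trans (∑-linear G x′ _)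
         (cong (G * sum x′ +_) (∑-const k (a * G + b * G + T))))))) ⟩
  k * sum (λ s → (a + x s) * (b + x′ s)) + (G * sum x + (G * sum x′ + k * (a * G + b * G + T)))
    ≡⟨ cong (λ z → k * z + (G * sum x + (G * sum x′ + k * (a * G + b * G + T)))) (∑-product a b x x′) ⟩
  k * (k * (a * b) + a * sum x′ + b * sum x + sum (λ s → x s * x′ s)) + (G * sum x + (G * sum x′ + k * (a * G + b * G + T)))
    ≡⟨ cong₂ (λ g h → k * (k * (a * b) + a * h + b * g + sum (λ s → x s * x′ s)) + (G * g + (G * h + k * (a * G + b * G + T)))) ∑x ∑x′ ⟩
  k * (k * (a * b) + a * G + b * G + sum (λ s → x s * x′ s)) + (G * G + (G * G + k * (a * G + b * G + T)))
    ≡⟨ cong (λ z → k * (k * (a * b) + a * G + b * G + z) + (G * G + (G * G + k * (a * G + b * G + T)))) ∑xx′ ⟩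
  k * (k * (a * b) + a * G + b * G + T) + (G * G + (G * G + k * (a * G + b * G + T)))
    ≡⟨ collect k a b G T ⟩
  k * k * (a * b) + (a + b) * (2 * k * G) + (2 * k * T + 2 * G * G) ∎
  where
  open ≡-Reasoning
  regroup : ∀ k c e a b G T x x′ → k * (c * e) + (a + x) * G + (b + x′) * G + T ≡
    k * (c * e) + (G * x + (G * x′ + (a * G + b * G + T)))
  regroup = solve-∀
  collect : ∀ k a b G T → k * (k * (a * b) + a * G + b * G + T) + (G * G + (G * G + k * (a * G + b * G + T))) ≡
    k * k * (a * b) + (a + b) * (2 * k * G) + (2 * k * T + 2 * G * G)
  collect = solve-∀

-- The counting is done for abstract orientation functions, free of coordinates: `χ` for the
-- blow-up, `χᴾ` and `χˢ` for its ingredients. `d p q` and `d′ p q` say that q lies left or right of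
-- the line chosen through p, and `lt` is the order of a cluster along its line, the same in every
-- cluster.
module BlowUp {m k} (h : ℕ)
  (χ : Fin m → Fin k → Fin m → Fin k → Fin m → Fin k → Bool)
  (χᴾ : Fin m → Fin m → Fin m → Bool) (χˢ : Fin k → Fin k → Fin k → Bool)
  (d d′ : Fin m → Fin m → Bool) (lt : Fin k → Fin k → Bool)
  (χ-apart : ∀ {p q r} s t u → p ≢ q → q ≢ r → p ≢ r → χ p s q t r u ≡ χᴾ p q r)
  (χ-pair : ∀ {p q} s t u → p ≢ q →
    ind (χ p s p t q u) ≡ ind (d p q) * ind (lt s t) + ind (d′ p q) * ind (lt t s))
  (χ-cluster : ∀ p s t u → χ p s p t p u ≡ χˢ s t u)
  (χ-rotate : ∀ p s q t r u → χ p s q t r u ≡ χ q t r u p s)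
  (χᴾ-aba : ∀ p q → χᴾ p q p ≡ false) (χᴾ-abb : ∀ p q → χᴾ p q q ≡ false) (χᴾ-aab : ∀ p q → χᴾ p p q ≡ false)
  (χˢ-aab : ∀ s t → χˢ s s t ≡ false)
  (d-refl : ∀ p → d p p ≡ false) (d′-refl : ∀ p → d′ p p ≡ false)
  (d-connex : ∀ {p q} → p ≢ q → ind (d p q) + ind (d′ p q) ≡ 1)
  (∑-d : ∀ p → sum (λ q → ind (d p q)) ≡ h) (∑-d′ : ∀ p → sum (λ q → ind (d′ p q)) ≡ h)
  (lt-irrefl : ∀ s → lt s s ≡ false)
  (lt-connex : ∀ {s t} → s ≢ t → lt t s ≡ not (lt s t))
  (lt-trans : ∀ s t u → lt s t ≡ true → lt t u ≡ true → lt s u ≡ true)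
  where

  open StrictTotalOrder lt lt-irrefl lt-connex lt-trans

  L : Fin m → Fin k → Fin m → Fin k → ℕ
  L p s q t = sum (λ r → sum (λ u → ind (χ p s q t r u)))

  Lᴾ : Fin m → Fin m → ℕ
  Lᴾ p q = sum (λ r → ind (χᴾ p q r))

  Lˢ : Fin k → Fin k → ℕ
  Lˢ s t = sum (λ u → ind (χˢ s t u))

  private
    D D′ : Fin m → Fin m → ℕ
    D p q = ind (d p q)
    D′ p q = ind (d′ p q)

    lt₁ : Fin k → Fin k → ℕ
    lt₁ s t = ind (lt s t)

    -- The number of points of cluster p to the left (`A`) or right (`A′`) of the directed line from
    -- its point s to any point of cluster q: those below s and those above s, in the order given by
    -- the side of q.
    A A′ : Fin m → Fin m → Fin k → ℕ
    A p q s = D p q * below s + D′ p q * above s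
    A′ p q s = D p q * above s + D′ p q * below s

    G T : ℕ
    G = k C 2
    T = k C 3

  -- A line through two points of cluster p follows the chosen line through p and so has h whole
  -- clusters on each side. Swapping s and t swaps the sides, but both hold k h points.
  L-same : ∀ p s t → L p s p t ≡ Lˢ s t + k * h * distinct s t
  L-same p s t = begin
    L p s p t
      ≡⟨ sum-cong-≗ cluster ⟩
    sum (λ r → δ p r * Lˢ s t + k * (D p r * lt₁ s t + D′ p r * lt₁ t s))
      ≡⟨ ∑-distrib-+ (λ r → δ p r * Lˢ s t) _ ⟩
    sum (λ r → δ p r * Lˢ s t) + sum (λ r → k * (D p r * lt₁ s t + D′ p r * lt₁ t s))
      ≡⟨ cong₂ _+_ (∑-δ p (λ _ → Lˢ s t)) (sym (*-distribˡ-sum k (λ r → D p r * lt₁ s t + D′ p r * lt₁ t s))) ⟩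
    Lˢ s t + k * sum (λ r → D p r * lt₁ s t + D′ p r * lt₁ t s)
      ≡⟨ cong (λ z → Lˢ s t + k * z) (trans (∑-distrib-+ (λ r → D p r * lt₁ s t) _)
           (cong₂ _+_ (trans (sym (*-distribʳ-sum (lt₁ s t) (D p))) (cong (_* lt₁ s t) (∑-d p)))
                      (trans (sym (*-distribʳ-sum (lt₁ t s) (D′ p))) (cong (_* lt₁ t s) (∑-d′ p))))) ⟩
    Lˢ s t + k * (h * lt₁ s t + h * lt₁ t s)
      ≡⟨ cong (Lˢ s t +_) (factor k h (lt₁ s t) (lt₁ t s)) ⟩
    Lˢ s t + k * h * distinct s t ∎
    where
    open ≡-Reasoning
    factor : ∀ k h a b → k * (h * a + h * b) ≡ k * h * (a + b)
    factor = solve-∀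
    cluster : ∀ r → sum (λ u → ind (χ p s p t r u)) ≡ δ p r * Lˢ s t + k * (D p r * lt₁ s t + D′ p r * lt₁ t s)
    cluster r with p ≟ r
    ... | yes refl rewrite d-refl p | d′-refl p | ℕ.*-zeroʳ k | ℕ.+-identityʳ (Lˢ s t) | ℕ.+-identityʳ (Lˢ s t)
        = sum-cong-≗ (λ u → cong ind (χ-cluster p s t u))
    ... | no p≢r = trans (sum-cong-≗ (λ u → χ-pair s t u p≢r)) (∑-const k _)

  -- Every third cluster lies wholly on one side; only the clusters p and q are cut by the line.
  L-apart : ∀ {p q} s t → p ≢ q → L p s q t ≡ k * Lᴾ p q + (A p q s + A′ q p t)
  L-apart {p} {q} s t p≢q = begin
    L p s q t
      ≡⟨ sum-cong-≗ cluster ⟩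
    sum (λ r → k * ind (χᴾ p q r) + (δ p r * A p q s + δ q r * A′ q p t))
      ≡⟨ ∑-linear k (λ r → ind (χᴾ p q r)) _ ⟩
    k * Lᴾ p q + sum (λ r → δ p r * A p q s + δ q r * A′ q p t)
      ≡⟨ cong (k * Lᴾ p q +_) (trans (∑-distrib-+ (λ r → δ p r * A p q s) _)
           (cong₂ _+_ (∑-δ p (λ _ → A p q s)) (∑-δ q (λ _ → A′ q p t)))) ⟩
    k * Lᴾ p q + (A p q s + A′ q p t) ∎
    where
    open ≡-Reasoning
    q≢p : q ≢ p
    q≢p e = p≢q (sym e)
    inP : sum (λ u → ind (χ p s q t p u)) ≡ A p q s
    inP = trans (sum-cong-≗ λ u → trans (cong ind (sym (χ-rotate p u p s q t))) (χ-pair u s t p≢q))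
      (trans (∑-linear (D p q) (λ u → lt₁ u s) (λ u → D′ p q * lt₁ s u))
        (cong (D p q * below s +_) (sym (*-distribˡ-sum (D′ p q) (λ u → lt₁ s u)))))
    inQ : sum (λ u → ind (χ p s q t q u)) ≡ A′ q p t
    inQ = trans (sum-cong-≗ λ u → trans (cong ind (χ-rotate p s q t q u)) (χ-pair t u s q≢p))
      (trans (∑-linear (D q p) (λ u → lt₁ t u) (λ u → D′ q p * lt₁ u t))
        (cong (D q p * above t +_) (sym (*-distribˡ-sum (D′ q p) (λ u → lt₁ u t)))))
    cluster : ∀ r → sum (λ u → ind (χ p s q t r u)) ≡ k * ind (χᴾ p q r) + (δ p r * A p q s + δ q r * A′ q p t)
    cluster r with p ≟ r | q ≟ r
    ... | yes refl | yes refl = ⊥-elim (p≢q refl)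
    ... | yes refl | no _ rewrite χᴾ-aba p q | ℕ.*-zeroʳ k = trans inP (pad (A p q s))
      where
      pad : ∀ a → a ≡ 1 * a + 0
      pad = solve-∀
    ... | no _ | yes refl rewrite χᴾ-abb p q | ℕ.*-zeroʳ k = trans inQ (sym (ℕ.+-identityʳ (A′ q p t)))
    ... | no p≢r | no q≢r = trans (sum-cong-≗ (λ u → cong ind (χ-apart s t u p≢q q≢r p≢r)))
          (trans (∑-const k _) (sym (ℕ.+-identityʳ _)))

  private
    unit-combination : ∀ a b {c e z} → a + b ≡ 1 → c ≡ z → e ≡ z → a * c + b * e ≡ z
    unit-combination a b {z = z} a+b refl refl =
      trans (sym (ℕ.*-distribʳ-+ z a b)) (trans (cong (_* z) a+b) (ℕ.+-identityʳ z))

    ∑-A : ∀ p q → p ≢ q → sum (A p q) ≡ G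
    ∑-A p q p≢q = trans (∑-linear (D p q) below (λ s → D′ p q * above s))
      (trans (cong (D p q * sum below +_) (sym (*-distribˡ-sum (D′ p q) above)))
        (unit-combination (D p q) (D′ p q) (d-connex p≢q) ∑-below ∑-above))

    ∑-A′ : ∀ p q → p ≢ q → sum (A′ p q) ≡ G
    ∑-A′ p q p≢q = trans (∑-linear (D p q) above (λ s → D′ p q * below s))
      (trans (cong (D p q * sum above +_) (sym (*-distribˡ-sum (D′ p q) below)))
        (unit-combination (D p q) (D′ p q) (d-connex p≢q) ∑-above ∑-below))

    ∑-AA′ : ∀ p q → p ≢ q → sum (λ s → A p q s * A′ p q s) ≡ T
    ∑-AA′ p q p≢q = trans (sum-cong-≗ (λ s → prod (d p q) (d′ p q) (d-connex p≢q) (below s) (above s))) ∑-below*above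
      where
      prod : ∀ a b → ind a + ind b ≡ 1 → ∀ x y → (ind a * x + ind b * y) * (ind a * y + ind b * x) ≡ x * y
      prod true  false _ x y = lem x y
        where
        lem : ∀ x y → (1 * x + 0 * y) * (1 * y + 0 * x) ≡ x * y
        lem = solve-∀
      prod false true  _ x y = lem x y
        where
        lem : ∀ x y → (0 * x + 1 * y) * (0 * y + 1 * x) ≡ x * y
        lem = solve-∀

  pairs-apart : ∀ p q → p ≢ q → sum (λ s → sum (λ t → L p s q t * L q t p s)) ≡
      k * k * ((k * Lᴾ p q) * (k * Lᴾ q p)) + (k * Lᴾ p q + k * Lᴾ q p) * (2 * k * G) + (2 * k * T + 2 * G * G)
  pairs-apart p q p≢q = trans (sum-cong-≗ (λ s → sum-cong-≗ (λ t → cong₂ _*_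
        (trans (L-apart s t p≢q) (sym (ℕ.+-assoc (k * Lᴾ p q) (A p q s) (A′ q p t))))
        (trans (L-apart t s q≢p) (swap (k * Lᴾ q p) (A q p t) (A′ p q s))))))
      (∑∑-product (k * Lᴾ p q) (k * Lᴾ q p) G T (A p q) (A′ p q) (A′ q p) (A q p)
        (∑-A p q p≢q) (∑-A′ p q p≢q) (∑-A′ q p q≢p) (∑-A q p q≢p) (∑-AA′ p q p≢q)
        (trans (sum-cong-≗ λ t → ℕ.*-comm (A′ q p t) (A q p t)) (∑-AA′ q p q≢p)))
      where
      q≢p : q ≢ p
      q≢p e = p≢q (sym e)
      swap : ∀ a b c → a + (b + c) ≡ a + c + b
      swap = solve-∀

  -- Both factors gain k h, so the product grows by k h times the sum of the factors plus (k h)².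
  -- That sum is k - 2 for s ≢ t, which makes the growth the same for all pairs.
  pairs-same : (∀ {s t} → s ≢ t → Lˢ s t + Lˢ t s ≡ k ∸ 2) → ∀ p →
    sum (λ s → sum (λ t → L p s p t * L p t p s)) ≡
    sum (λ s → sum (λ t → Lˢ s t * Lˢ t s)) + 2 * G * (k * h * (k ∸ 2) + k * h * (k * h))
  pairs-same Lˢ-sum p = begin
    sum (λ s → sum (λ t → L p s p t * L p t p s))
      ≡⟨ sum-cong-≗ (λ s → sum-cong-≗ (λ t → trans (cong₂ _*_ (L-same p s t) (L-same p t s)) (product s t))) ⟩
    sum (λ s → sum (λ t → Lˢ s t * Lˢ t s + distinct s t * c))
      ≡⟨ sum-cong-≗ (λ s → trans (∑-distrib-+ (λ t → Lˢ s t * Lˢ t s) (λ t → distinct s t * c))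
           (cong (sum (λ t → Lˢ s t * Lˢ t s) +_) (sym (*-distribʳ-sum c (distinct s))))) ⟩
    sum (λ s → sum (λ t → Lˢ s t * Lˢ t s) + sum (distinct s) * c)
      ≡⟨ ∑-distrib-+ (λ s → sum (λ t → Lˢ s t * Lˢ t s)) (λ s → sum (distinct s) * c) ⟩
    Z + sum (λ s → sum (distinct s) * c)
      ≡⟨ cong (Z +_) (*-distribʳ-sum c (λ s → sum (distinct s))) ⟨
    Z + sum (λ s → sum (distinct s)) * c
      ≡⟨ cong (λ z → Z + z * c) ∑-distinct ⟩
    Z + 2 * G * c ∎
    where
    open ≡-Reasoning
    Z c : ℕ
    Z = sum (λ s → sum (λ t → Lˢ s t * Lˢ t s))
    c = k * h * (k ∸ 2) + k * h * (k * h)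
    Lˢ-refl : ∀ s → Lˢ s s ≡ 0
    Lˢ-refl s = ∑-zero {k} (λ u → cong ind (χˢ-aab s u))
    product : ∀ s t → (Lˢ s t + k * h * distinct s t) * (Lˢ t s + k * h * distinct t s) ≡ Lˢ s t * Lˢ t s + distinct s t * c
    product s t with s ≟ t
    ... | yes refl rewrite distinct-refl s | Lˢ-refl s | ℕ.*-zeroʳ (k * h) = refl
    ... | no s≢t rewrite distinct-≢ s≢t | distinct-≢ {t} {s} (λ e → s≢t (sym e)) | sym (Lˢ-sum s≢t)
        = lem (Lˢ s t) (Lˢ t s) (k * h)
      where
      lem : ∀ a b c → (a + c * 1) * (b + c * 1) ≡ a * b + 1 * (c * (a + b) + c * c)
      lem = solve-∀

  pairs-total : (∀ {s t} → s ≢ t → Lˢ s t + Lˢ t s ≡ k ∸ 2) → (∀ {p q} → p ≢ q → Lᴾ p q + Lᴾ q p ≡ m ∸ 2) →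
    sum (λ p → sum (λ s → sum (λ q → sum (λ t → L p s q t * L q t p s)))) ≡
    k * k * (k * k) * sum (λ p → sum (λ q → Lᴾ p q * Lᴾ q p))
    + m * (m ∸ 1) * (k * (m ∸ 2) * (2 * k * G) + (2 * k * T + 2 * G * G))
    + m * (sum (λ s → sum (λ t → Lˢ s t * Lˢ t s)) + 2 * G * (k * h * (k ∸ 2) + k * h * (k * h)))
  pairs-total Lˢ-sum Lᴾ-sum = begin
    sum (λ p → sum (λ s → sum (λ q → sum (λ t → L p s q t * L q t p s))))
      ≡⟨ sum-cong-≗ (λ p → ∑-comm (λ s q → sum (λ t → L p s q t * L q t p s))) ⟩
    sum (λ p → sum (λ q → sum (λ s → sum (λ t → L p s q t * L q t p s))))
      ≡⟨ sum-cong-≗ (λ p → sum-cong-≗ (λ q → cluster-pair p q)) ⟩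
    sum (λ p → sum (λ q → k⁴ * (Lᴾ p q * Lᴾ q p) + (δ p q * Z + δ̅ p q * W)))
      ≡⟨ sum-cong-≗ (λ p → trans (∑-linear k⁴ (λ q → Lᴾ p q * Lᴾ q p) _)
           (cong (k⁴ * sum (λ q → Lᴾ p q * Lᴾ q p) +_)
             (trans (∑-distrib-+ (λ q → δ p q * Z) (λ q → δ̅ p q * W))
               (cong₂ _+_ (∑-δ p (λ _ → Z)) (trans (sym (*-distribʳ-sum W (δ̅ p))) (cong (_* W) (∑-δ̅ p))))))) ⟩
    sum (λ p → k⁴ * sum (λ q → Lᴾ p q * Lᴾ q p) + (Z + (m ∸ 1) * W))
      ≡⟨ trans (∑-linear k⁴ (λ p → sum (λ q → Lᴾ p q * Lᴾ q p)) _)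
           (cong (k⁴ * sum (λ p → sum (λ q → Lᴾ p q * Lᴾ q p)) +_) (∑-const m (Z + (m ∸ 1) * W))) ⟩
    k⁴ * sum (λ p → sum (λ q → Lᴾ p q * Lᴾ q p)) + m * (Z + (m ∸ 1) * W)
      ≡⟨ regroup (k⁴ * sum (λ p → sum (λ q → Lᴾ p q * Lᴾ q p))) m Z (m ∸ 1) W ⟩
    k⁴ * sum (λ p → sum (λ q → Lᴾ p q * Lᴾ q p)) + m * (m ∸ 1) * W + m * Z ∎
    where
    open ≡-Reasoning
    k⁴ W Z : ℕ
    k⁴ = k * k * (k * k)
    -- What two different clusters contribute besides k⁴ `Lᴾ p q` `Lᴾ q p`. It is the same for all
    -- pairs because `Lᴾ p q + Lᴾ q p` is constant.
    W = k * (m ∸ 2) * (2 * k * G) + (2 * k * T + 2 * G * G)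
    Z = sum (λ s → sum (λ t → Lˢ s t * Lˢ t s)) + 2 * G * (k * h * (k ∸ 2) + k * h * (k * h))
    regroup : ∀ a m z m′ w → a + m * (z + m′ * w) ≡ a + m * m′ * w + m * z
    regroup = solve-∀
    δ̅ : Fin m → Fin m → ℕ
    δ̅ p q = 1 ∸ δ p q
    δ+δ̅ : ∀ p q → δ p q + δ̅ p q ≡ 1
    δ+δ̅ p q with p ≟ q
    ... | yes _ = refl
    ... | no _  = refl
    ∑-δ̅ : ∀ p → sum (δ̅ p) ≡ m ∸ 1
    ∑-δ̅ p = cong (_∸ 1) (begin
      1 + sum (δ̅ p)           ≡⟨ cong (_+ sum (δ̅ p)) (trans (sum-cong-≗ (λ q → sym (ℕ.*-identityʳ (δ p q)))) (∑-δ p (λ _ → 1))) ⟨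
      sum (δ p) + sum (δ̅ p)   ≡⟨ ∑-distrib-+ (δ p) (δ̅ p) ⟨
      sum (λ q → δ p q + δ̅ p q) ≡⟨ trans (sum-cong-≗ (δ+δ̅ p)) (sum-1 m) ⟩
      m ∎)
    Lᴾ-refl : ∀ p → Lᴾ p p ≡ 0
    Lᴾ-refl p = ∑-zero {m} (λ u → cong ind (χᴾ-aab p u))
    cluster-pair : ∀ p q → sum (λ s → sum (λ t → L p s q t * L q t p s)) ≡
      k⁴ * (Lᴾ p q * Lᴾ q p) + (δ p q * Z + δ̅ p q * W)
    cluster-pair p q with p ≟ q
    ... | yes refl rewrite Lᴾ-refl p | ℕ.*-zeroʳ k⁴ = trans (pairs-same Lˢ-sum p) (pad Z)
      where
      pad : ∀ z → z ≡ 1 * z + 0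
      pad = solve-∀
    ... | no p≢q rewrite sym (Lᴾ-sum p≢q) = trans (pairs-apart p q p≢q) (lem k (Lᴾ p q) (Lᴾ q p) G T)
      where
      lem : ∀ k a b G T → k * k * ((k * a) * (k * b)) + (k * a + k * b) * (2 * k * G) + (2 * k * T + 2 * G * G) ≡
        k * k * (k * k) * (a * b) + (0 + 1 * (k * (a + b) * (2 * k * G) + (2 * k * T + 2 * G * G)))
      lem = solve-∀

-- Geometry of a blow-up

-- Since `pos` does not distinguish zero from a negative number, it is recorded separately that x is
-- nonzero.
SameSign : ℤ → ℤ → Set
SameSign x a = pos x ≡ pos a × x ≢ 0ℤ

i≤∣i∣ : ∀ i → i ≤ᶻ ⁺ ∣ i ∣
i≤∣i∣ (⁺ n)    = ℤₚ.≤-refl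
i≤∣i∣ -[1+ n ] = ℤ.-≤+

dominate⁺ : ∀ A B N → 0ℤ <ᶻ A → ∣ B ∣ < N → 0ℤ <ᶻ ⁺ N *ᶻ A +ᶻ B
dominate⁺ (⁺ suc a) B N (+<+ _) ∣B∣<N =
  subst (_<ᶻ ⁺ N *ᶻ ⁺ suc a +ᶻ B) (ℤₚ.+-inverseˡ B) (ℤₚ.+-monoˡ-< B
    (ℤₚ.≤-<-trans (i≤∣i∣ (-ᶻ B)) (ℤₚ.<-≤-trans (+<+ (subst (_< N) (sym (ℤₚ.∣-i∣≡∣i∣ B)) ∣B∣<N))
      (subst (⁺ N ≤ᶻ_) (ℤₚ.pos-* N (suc a)) (+≤+ (ℕ.m≤m*n N (suc a)))))))

-- A nonzero integer has absolute value at least 1, so N A outweighs B. This is the substitute for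
-- choosing something sufficiently small.
dominate : ∀ A B N → A ≢ 0ℤ → ∣ B ∣ < N → SameSign (⁺ N *ᶻ A +ᶻ B) A
dominate A B N A≢0 ∣B∣<N with pos A in e
... | true  = pos-true 0<x , λ x≡0 → ℤₚ.<⇒≢ 0<x (sym x≡0)
  where
  0<x = dominate⁺ A B N (pos-true⁻¹ A e) ∣B∣<N
... | false = pos-false (ℤₚ.<⇒≤ x<0) , ℤₚ.<⇒≢ x<0
  where
  neg-sum : ∀ n a b → n *ᶻ (-ᶻ a) +ᶻ (-ᶻ b) ≡ -ᶻ (n *ᶻ a +ᶻ b)
  neg-sum = ℤ-Solver.solve-∀
  x<0 : ⁺ N *ᶻ A +ᶻ B <ᶻ 0ℤ
  x<0 = subst (_<ᶻ 0ℤ) (trans (cong -ᶻ_ (neg-sum (⁺ N) A B)) (ℤₚ.neg-involutive _))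
    (ℤₚ.neg-mono-< (dominate⁺ (-ᶻ A) (-ᶻ B) N (ℤₚ.neg-mono-< (ℤₚ.≤∧≢⇒< (pos-false⁻¹ A e) A≢0))
      (subst (_< N) (sym (ℤₚ.∣-i∣≡∣i∣ B)) ∣B∣<N)))

SameSign-trans : ∀ {x y z} → SameSign x y → SameSign y z → SameSign x z
SameSign-trans (p , x≢0) (q , _) = trans p q , x≢0

cross : Point → Point → ℤ
cross (a , b) (c , d) = a *ᶻ d -ᶻ b *ᶻ c

dot : Point → Point → ℤ
dot (a , b) (c , d) = a *ᶻ c +ᶻ b *ᶻ d

_⊕_ _⊝_ : Point → Point → Point
(a , b) ⊕ (c , d) = a +ᶻ c , b +ᶻ d
(a , b) ⊝ (c , d) = a -ᶻ c , b -ᶻ d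

_∙_ : ℤ → Point → Point
n ∙ (a , b) = n *ᶻ a , n *ᶻ b

-- A flattened copy of the point z: the first axis is stretched along the
-- vector v, the second one is turned to the normal of v.
flat : ℤ → Point → Point → Point
flat H (vx , vy) (x , y) = H *ᶻ (x *ᶻ vx) -ᶻ y *ᶻ vy , H *ᶻ (x *ᶻ vy) +ᶻ y *ᶻ vx

-- The terms of the determinant that are bilinear in a difference of large vectors and a difference
-- of small ones.
mixed : (a b c e f g : Point) → ℤ
mixed a b c e f g = cross (b ⊝ a) (g ⊝ e) +ᶻ cross (f ⊝ e) (c ⊝ a)

-- The expansion in N is kept in Horner form, so that `dominate` applies from the inside outwards:
-- first against `mixed`, then against the determinant of the small vectors.
orient-scale : ∀ N a b c e f g →
  orient ((N ∙ a) ⊕ e) ((N ∙ b) ⊕ f) ((N ∙ c) ⊕ g) ≡ N *ᶻ (N *ᶻ orient a b c +ᶻ mixed a b c e f g) +ᶻ orient e f g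
orient-scale N (ax , ay) (bx , by) (cx , cy) (ex , ey) (fx , fy) (gx , gy) =
  lem N ax ay bx by cx cy ex ey fx fy gx gy
  where
  lem : ∀ N ax ay bx by cx cy ex ey fx fy gx gy →
    ((N *ᶻ bx +ᶻ fx) -ᶻ (N *ᶻ ax +ᶻ ex)) *ᶻ ((N *ᶻ cy +ᶻ gy) -ᶻ (N *ᶻ ay +ᶻ ey)) -ᶻ
    ((N *ᶻ by +ᶻ fy) -ᶻ (N *ᶻ ay +ᶻ ey)) *ᶻ ((N *ᶻ cx +ᶻ gx) -ᶻ (N *ᶻ ax +ᶻ ex)) ≡
    N *ᶻ (N *ᶻ ((bx -ᶻ ax) *ᶻ (cy -ᶻ ay) -ᶻ (by -ᶻ ay) *ᶻ (cx -ᶻ ax)) +ᶻ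
      (((bx -ᶻ ax) *ᶻ (gy -ᶻ ey) -ᶻ (by -ᶻ ay) *ᶻ (gx -ᶻ ex)) +ᶻ
       ((fx -ᶻ ex) *ᶻ (cy -ᶻ ay) -ᶻ (fy -ᶻ ey) *ᶻ (cx -ᶻ ax)))) +ᶻ
    ((fx -ᶻ ex) *ᶻ (gy -ᶻ ey) -ᶻ (fy -ᶻ ey) *ᶻ (gx -ᶻ ex))
  lem = ℤ-Solver.solve-∀

-- With two points in one cluster the leading determinant vanishes, and the sign passes to the next
-- order in N: the direction of the small segment against the vector from a to c.
orient-scale₂ : ∀ N a c e f g →
  orient ((N ∙ a) ⊕ e) ((N ∙ a) ⊕ f) ((N ∙ c) ⊕ g) ≡ N *ᶻ cross (f ⊝ e) (c ⊝ a) +ᶻ orient e f g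
orient-scale₂ N (ax , ay) (cx , cy) (ex , ey) (fx , fy) (gx , gy) =
  lem N ax ay cx cy ex ey fx fy gx gy
  where
  lem : ∀ N ax ay cx cy ex ey fx fy gx gy →
    ((N *ᶻ ax +ᶻ fx) -ᶻ (N *ᶻ ax +ᶻ ex)) *ᶻ ((N *ᶻ cy +ᶻ gy) -ᶻ (N *ᶻ ay +ᶻ ey)) -ᶻ
    ((N *ᶻ ay +ᶻ fy) -ᶻ (N *ᶻ ay +ᶻ ey)) *ᶻ ((N *ᶻ cx +ᶻ gx) -ᶻ (N *ᶻ ax +ᶻ ex)) ≡
    N *ᶻ ((fx -ᶻ ex) *ᶻ (cy -ᶻ ay) -ᶻ (fy -ᶻ ey) *ᶻ (cx -ᶻ ax)) +ᶻ
    ((fx -ᶻ ex) *ᶻ (gy -ᶻ ey) -ᶻ (fy -ᶻ ey) *ᶻ (gx -ᶻ ex))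
  lem = ℤ-Solver.solve-∀

orient-translate : ∀ a e f g → orient (a ⊕ e) (a ⊕ f) (a ⊕ g) ≡ orient e f g
orient-translate (ax , ay) (ex , ey) (fx , fy) (gx , gy) = lem ax ay ex ey fx fy gx gy
  where
  lem : ∀ ax ay ex ey fx fy gx gy →
    ((ax +ᶻ fx) -ᶻ (ax +ᶻ ex)) *ᶻ ((ay +ᶻ gy) -ᶻ (ay +ᶻ ey)) -ᶻ
    ((ay +ᶻ fy) -ᶻ (ay +ᶻ ey)) *ᶻ ((ax +ᶻ gx) -ᶻ (ax +ᶻ ex)) ≡
    (fx -ᶻ ex) *ᶻ (gy -ᶻ ey) -ᶻ (fy -ᶻ ey) *ᶻ (gx -ᶻ ex)
  lem = ℤ-Solver.solve-∀

-- The map `flat H v` is linear with determinant H |v|².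
orient-flat : ∀ H v x y z → orient (flat H v x) (flat H v y) (flat H v z) ≡ H *ᶻ (dot v v *ᶻ orient x y z)
orient-flat H (vx , vy) (ax , ay) (bx , by) (cx , cy) = lem H vx vy ax ay bx by cx cy
  where
  lem : ∀ H vx vy ax ay bx by cx cy →
    ((H *ᶻ (bx *ᶻ vx) -ᶻ by *ᶻ vy) -ᶻ (H *ᶻ (ax *ᶻ vx) -ᶻ ay *ᶻ vy)) *ᶻ
      ((H *ᶻ (cx *ᶻ vy) +ᶻ cy *ᶻ vx) -ᶻ (H *ᶻ (ax *ᶻ vy) +ᶻ ay *ᶻ vx)) -ᶻ
    ((H *ᶻ (bx *ᶻ vy) +ᶻ by *ᶻ vx) -ᶻ (H *ᶻ (ax *ᶻ vy) +ᶻ ay *ᶻ vx)) *ᶻ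
      ((H *ᶻ (cx *ᶻ vx) -ᶻ cy *ᶻ vy) -ᶻ (H *ᶻ (ax *ᶻ vx) -ᶻ ay *ᶻ vy)) ≡
    H *ᶻ ((vx *ᶻ vx +ᶻ vy *ᶻ vy) *ᶻ ((bx -ᶻ ax) *ᶻ (cy -ᶻ ay) -ᶻ (by -ᶻ ay) *ᶻ (cx -ᶻ ax)))
  lem = ℤ-Solver.solve-∀

-- For large H the sign is decided by the order of the abscissae of x and y and the side of c
-- relative to the line av; the ordinates enter only the error term.
cross-flat : ∀ H a v c x y → cross (flat H (v ⊝ a) y ⊝ flat H (v ⊝ a) x) (c ⊝ a) ≡
  H *ᶻ ((proj₁ y -ᶻ proj₁ x) *ᶻ orient a v c) +ᶻ (proj₂ x -ᶻ proj₂ y) *ᶻ dot (v ⊝ a) (c ⊝ a)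
cross-flat H (ax , ay) (vx , vy) (cx , cy) (x₁ , x₂) (y₁ , y₂) = lem H ax ay vx vy cx cy x₁ x₂ y₁ y₂
  where
  lem : ∀ H ax ay vx vy cx cy x₁ x₂ y₁ y₂ →
    ((H *ᶻ (y₁ *ᶻ (vx -ᶻ ax)) -ᶻ y₂ *ᶻ (vy -ᶻ ay)) -ᶻ (H *ᶻ (x₁ *ᶻ (vx -ᶻ ax)) -ᶻ x₂ *ᶻ (vy -ᶻ ay))) *ᶻ (cy -ᶻ ay) -ᶻ
    ((H *ᶻ (y₁ *ᶻ (vy -ᶻ ay)) +ᶻ y₂ *ᶻ (vx -ᶻ ax)) -ᶻ (H *ᶻ (x₁ *ᶻ (vy -ᶻ ay)) +ᶻ x₂ *ᶻ (vx -ᶻ ax))) *ᶻ (cx -ᶻ ax) ≡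
    H *ᶻ ((y₁ -ᶻ x₁) *ᶻ ((vx -ᶻ ax) *ᶻ (cy -ᶻ ay) -ᶻ (vy -ᶻ ay) *ᶻ (cx -ᶻ ax))) +ᶻ
    (x₂ -ᶻ y₂) *ᶻ ((vx -ᶻ ax) *ᶻ (cx -ᶻ ax) +ᶻ (vy -ᶻ ay) *ᶻ (cy -ᶻ ay))
  lem = ℤ-Solver.solve-∀

≤-∑ : (f : Fin n → ℕ) (i : Fin n) → f i ≤ sum f
≤-∑ {suc n} f zero    = ℕ.m≤m+n (f zero) (sum (λ j → f (suc j)))
≤-∑ {suc n} f (suc i) = ℕ.≤-trans (≤-∑ (λ j → f (suc j)) i) (ℕ.m≤n+m (sum (λ j → f (suc j))) (f zero))

≤-∑∑ : ∀ {m k} (f : Fin m → Fin k → ℕ) p s → f p s ≤ sum (λ p → sum (f p))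
≤-∑∑ f p s = ℕ.≤-trans (≤-∑ (f p) s) (≤-∑ (λ p → sum (f p)) p)

lefts-sum : (P : Config n) → GeneralPosition P → ∀ {i j} → i ≢ j → lefts P i j + lefts P j i ≡ n ∸ 2
lefts-sum {n} P (_ , noncollinear) {i} {j} i≢j = cong (_∸ 2) (begin
  2 + (lefts P i j + lefts P j i)
    ≡⟨ cong₂ (λ a b → a + b + (lefts P i j + lefts P j i)) (∑-δ′ i) (∑-δ′ j) ⟨
  sum (δ i) + sum (δ j) + (lefts P i j + lefts P j i)
    ≡⟨ cong₂ _+_ (∑-distrib-+ (δ i) (δ j)) (∑-distrib-+ (l i j) (l j i)) ⟨
  sum (λ k → δ i k + δ j k) + sum (λ k → l i j k + l j i k)
    ≡⟨ ∑-distrib-+ (λ k → δ i k + δ j k) (λ k → l i j k + l j i k) ⟨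
  sum (λ k → δ i k + δ j k + (l i j k + l j i k))
    ≡⟨ trans (sum-cong-≗ one) (sum-1 n) ⟩
  n ∎)
  where
  open ≡-Reasoning
  l : Fin n → Fin n → Fin n → ℕ
  l i j k = ind (left (P i) (P j) (P k))
  ∑-δ′ : ∀ i → sum (δ i) ≡ 1
  ∑-δ′ i = trans (sum-cong-≗ (λ k → sym (ℕ.*-identityʳ (δ i k)))) (∑-δ i (λ _ → 1))
  one : ∀ k → δ i k + δ j k + (l i j k + l j i k) ≡ 1
  one k with i ≟ k | j ≟ k
  ... | yes refl | yes refl = ⊥-elim (i≢j refl)
  ... | yes refl | no _ = cong₂ (λ a b → 1 + (ind a + ind b)) (left-aba (P i) (P j)) (left-abb (P j) (P i))
  ... | no _ | yes refl = cong₂ (λ a b → 1 + (ind a + ind b)) (left-abb (P i) (P j)) (left-aba (P j) (P i))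
  ... | no i≢k | no j≢k = trans (cong (λ b → l i j k + ind b) (left-swap (P i) (P j) (P k) (noncollinear i j k i≢j j≢k i≢k)))
        (ind-not (left (P i) (P j) (P k)))

thirdIndex : 3 ≤ n → (i j : Fin n) → ∃ λ k → i ≢ k × j ≢ k
thirdIndex (s≤s (s≤s (s≤s _))) zero          zero          = suc zero , (λ ()) , (λ ())
thirdIndex (s≤s (s≤s (s≤s _))) zero          (suc zero)    = suc (suc zero) , (λ ()) , (λ ())
thirdIndex (s≤s (s≤s (s≤s _))) zero          (suc (suc _)) = suc zero , (λ ()) , (λ ())
thirdIndex (s≤s (s≤s (s≤s _))) (suc zero)    zero          = suc (suc zero) , (λ ()) , (λ ())
thirdIndex (s≤s (s≤s (s≤s _))) (suc (suc _)) zero          = suc zero , (λ ()) , (λ ())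
thirdIndex (s≤s (s≤s (s≤s _))) (suc _)       (suc _)       = zero , (λ ()) , (λ ())

-- Two coinciding points would be collinear with any third point.
noncollinear⇒generalPosition : 3 ≤ n → (P : Config n) →
  (∀ i j k → i ≢ j → j ≢ k → i ≢ k → orient (P i) (P j) (P k) ≢ 0ℤ) → GeneralPosition P
noncollinear⇒generalPosition 3≤n P noncollinear = injective , noncollinear
  where
  injective : ∀ i j → P i ≡ P j → i ≡ j
  injective i j Pi≡Pj with i ≟ j
  ... | yes i≡j = i≡j
  ... | no i≢j with k , i≢k , j≢k ← thirdIndex 3≤n i j = ⊥-elim (noncollinear i j k i≢j j≢k i≢k
        (trans (cong (λ a → orient a (P j) (P k)) Pi≡Pj) (orient-refl (P j) (P k))))

pos-* : ∀ a b → a ≢ 0ℤ → b ≢ 0ℤ → pos (a *ᶻ b) ≡ (if pos b then pos a else not (pos a))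
pos-* (⁺ zero)    b           a≢0 b≢0 = ⊥-elim (a≢0 refl)
pos-* (⁺ suc m)   (⁺ zero)    a≢0 b≢0 = ⊥-elim (b≢0 refl)
pos-* -[1+ m ]    (⁺ zero)    a≢0 b≢0 = ⊥-elim (b≢0 refl)
pos-* (⁺ suc m)   (⁺ suc n)   a≢0 b≢0 = refl
pos-* (⁺ suc m)   -[1+ n ]    a≢0 b≢0 = refl
pos-* -[1+ m ]    (⁺ suc n)   a≢0 b≢0 = refl
pos-* -[1+ m ]    -[1+ n ]    a≢0 b≢0 = refl

pos-scale : ∀ c x → 0ℤ <ᶻ c → pos (c *ᶻ x) ≡ pos x
pos-scale (⁺ suc c) (⁺ zero)  _ = cong pos (ℤₚ.*-zeroʳ (⁺ suc c))
pos-scale (⁺ suc c) (⁺ suc x) _ = refl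
pos-scale (⁺ suc c) -[1+ x ]  _ = refl
pos-scale (⁺ zero)  x         (+<+ ())

*≢0 : ∀ a b → a ≢ 0ℤ → b ≢ 0ℤ → a *ᶻ b ≢ 0ℤ
*≢0 a b a≢0 b≢0 ab≡0 with ℤₚ.i*j≡0⇒i≡0∨j≡0 a ab≡0
... | inj₁ a≡0 = a≢0 a≡0
... | inj₂ b≡0 = b≢0 b≡0

0<-≢ : ∀ {x} → 0ℤ <ᶻ x → x ≢ 0ℤ
0<-≢ 0<x x≡0 = ℤₚ.<⇒≢ 0<x (sym x≡0)

0≤i*i : ∀ i → 0ℤ ≤ᶻ i *ᶻ i
0≤i*i (⁺ zero)   = ℤₚ.≤-refl
0≤i*i (⁺ suc n)  = +≤+ z≤n
0≤i*i -[1+ n ]   = +≤+ z≤n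

dot-positive : ∀ v → v ≢ (0ℤ , 0ℤ) → 0ℤ <ᶻ dot v v
dot-positive (⁺ zero    , ⁺ zero)    v≢0 = ⊥-elim (v≢0 refl)
dot-positive (⁺ zero    , ⁺ suc y)   v≢0 = +<+ (s≤s z≤n)
dot-positive (⁺ zero    , -[1+ y ])  v≢0 = +<+ (s≤s z≤n)
dot-positive (⁺ suc x   , y)         v≢0 = ℤₚ.+-mono-<-≤ {0ℤ} {⁺ suc x *ᶻ ⁺ suc x} {0ℤ} {y *ᶻ y} (+<+ (s≤s z≤n)) (0≤i*i y)
dot-positive (-[1+ x ]  , y)         v≢0 = ℤₚ.+-mono-<-≤ {0ℤ} { -[1+ x ] *ᶻ -[1+ x ]} {0ℤ} {y *ᶻ y} (+<+ (s≤s z≤n)) (0≤i*i y)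

-- A tie-break: points of S may share an abscissa, and for large K the new abscissae order them
-- lexicographically. The determinant of the map is K, so orientations survive for K > 0.
shear : ℤ → Point → Point
shear K (x , y) = K *ᶻ x +ᶻ y , y

orient-shear : ∀ K a b c → orient (shear K a) (shear K b) (shear K c) ≡ K *ᶻ orient a b c
orient-shear K (ax , ay) (bx , by) (cx , cy) = lem K ax ay bx by cx cy
  where
  lem : ∀ K ax ay bx by cx cy →
    ((K *ᶻ bx +ᶻ by) -ᶻ (K *ᶻ ax +ᶻ ay)) *ᶻ (cy -ᶻ ay) -ᶻ (by -ᶻ ay) *ᶻ ((K *ᶻ cx +ᶻ cy) -ᶻ (K *ᶻ ax +ᶻ ay)) ≡
    K *ᶻ ((bx -ᶻ ax) *ᶻ (cy -ᶻ ay) -ᶻ (by -ᶻ ay) *ᶻ (cx -ᶻ ax))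
  lem = ℤ-Solver.solve-∀

orient-zero : ∀ a b c → b ⊝ a ≡ (0ℤ , 0ℤ) → orient a b c ≡ 0ℤ
orient-zero a b c e = trans (cong (λ v → cross v (c ⊝ a)) e) (zeros (proj₁ (c ⊝ a)) (proj₂ (c ⊝ a)))
  where
  zeros : ∀ x y → cross (0ℤ , 0ℤ) (x , y) ≡ 0ℤ
  zeros x y = cong₂ _-ᶻ_ (ℤₚ.*-zeroˡ y) (ℤₚ.*-zeroˡ x)

-- The line chosen through `P p` also passes through `V p`, and by `line-generic` it misses the
-- other points of P. The copy of S at p is added to `P p` enlarged by a factor `N`, which keeps all
-- coordinates integral.
module Geometry {m k : ℕ} (P V : Config m) (S : Config k)
  (P-gp : GeneralPosition P) (S-gp : GeneralPosition S) (3≤m : 3 ≤ m)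
  (line-generic : ∀ {p q} → p ≢ q → orient (P p) (V p) (P q) ≢ 0ℤ) where

  private
    K H N : ℕ

    -- `K`, `H` and `N` are fixed in this order, since each error term involves the earlier scales:
    -- `K` separates the abscissae of S, `H` flattens the copies, `N` moves the clusters apart. One
    -- more than the sum of all absolute errors bounds each of them strictly.
    K = suc (sum (λ s → sum (λ t → ∣ proj₂ (S t) -ᶻ proj₂ (S s) ∣)))

    z : Fin k → Point
    z s = shear (⁺ K) (S s)

    H-error : Fin m → Fin m → Fin k → Fin k → ℤ
    H-error p q s t = (proj₂ (z s) -ᶻ proj₂ (z t)) *ᶻ dot (V p ⊝ P p) (P q ⊝ P p)

    H = suc (sum (λ p → sum (λ q → sum (λ s → sum (λ t → ∣ H-error p q s t ∣)))))

    e : Fin m → Fin k → Point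
    e p s = flat (⁺ H) (V p ⊝ P p) (z s)

    N-error₁ N-error₂ : Fin m → Fin k → Fin m → Fin k → Fin m → Fin k → ℤ
    N-error₁ p s q t r u = mixed (P p) (P q) (P r) (e p s) (e q t) (e r u)
    N-error₂ p s q t r u = orient (e p s) (e q t) (e r u)

    N = suc (sum (λ p → sum (λ s → sum (λ q → sum (λ t → sum (λ r → sum (λ u →
      ∣ N-error₁ p s q t r u ∣ + ∣ N-error₂ p s q t r u ∣)))))))

    K-bound : ∀ s t → ∣ proj₂ (S t) -ᶻ proj₂ (S s) ∣ < K
    K-bound s t = s≤s (≤-∑∑ (λ s t → ∣ proj₂ (S t) -ᶻ proj₂ (S s) ∣) s t)

    H-bound : ∀ p q s t → ∣ H-error p q s t ∣ < H
    H-bound p q s t = s≤s (ℕ.≤-trans (≤-∑∑ (λ s t → ∣ H-error p q s t ∣) s t)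
      (≤-∑∑ (λ p q → sum (λ s → sum (λ t → ∣ H-error p q s t ∣))) p q))

    N-bound : ∀ p s q t r u → ∣ N-error₁ p s q t r u ∣ + ∣ N-error₂ p s q t r u ∣ < N
    N-bound p s q t r u = s≤s (ℕ.≤-trans (≤-∑∑ (f p s q t) r u)
      (ℕ.≤-trans (≤-∑∑ (λ q t → sum (λ r → sum (f p s q t r))) q t)
        (≤-∑∑ (λ p s → sum (λ q → sum (λ t → sum (λ r → sum (f p s q t r))))) p s)))
      where
      f : Fin m → Fin k → Fin m → Fin k → Fin m → Fin k → ℕ
      f p s q t r u = ∣ N-error₁ p s q t r u ∣ + ∣ N-error₂ p s q t r u ∣

    N-bound₁ : ∀ p s q t r u → ∣ N-error₁ p s q t r u ∣ < N
    N-bound₁ p s q t r u = ℕ.≤-<-trans (ℕ.m≤m+n _ _) (N-bound p s q t r u)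

    N-bound₂ : ∀ p s q t r u → ∣ N-error₂ p s q t r u ∣ < N
    N-bound₂ p s q t r u = ℕ.≤-<-trans (ℕ.m≤n+m _ _) (N-bound p s q t r u)

  point : Fin m → Fin k → Point
  point p s = ((⁺ N) ∙ P p) ⊕ e p s

  apart : ∀ {p q r} s t u → p ≢ q → q ≢ r → p ≢ r →
    SameSign (orient (point p s) (point q t) (point r u)) (orient (P p) (P q) (P r))
  apart {p} {q} {r} s t u p≢q q≢r p≢r =
    subst (λ x → SameSign x (orient (P p) (P q) (P r)))
      (sym (orient-scale (⁺ N) (P p) (P q) (P r) (e p s) (e q t) (e r u)))
      (SameSign-trans {z = orient (P p) (P q) (P r)}
        (dominate (⁺ N *ᶻ orient (P p) (P q) (P r) +ᶻ N-error₁ p s q t r u) (N-error₂ p s q t r u) N (proj₂ inner) (N-bound₂ p s q t r u))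
        inner)
    where
    inner : SameSign (⁺ N *ᶻ orient (P p) (P q) (P r) +ᶻ N-error₁ p s q t r u) (orient (P p) (P q) (P r))
    inner = dominate (orient (P p) (P q) (P r)) (N-error₁ p s q t r u) N
      (proj₂ P-gp p q r p≢q q≢r p≢r) (N-bound₁ p s q t r u)

  lt : Fin k → Fin k → Bool
  lt s t = pos (proj₁ (z t) -ᶻ proj₁ (z s))

  private
    difference : ∀ s t → ⁺ K *ᶻ (proj₁ (S t) -ᶻ proj₁ (S s)) +ᶻ (proj₂ (S t) -ᶻ proj₂ (S s)) ≡ proj₁ (z t) -ᶻ proj₁ (z s)
    difference s t = lem (⁺ K) (proj₁ (S t)) (proj₁ (S s)) (proj₂ (S t)) (proj₂ (S s))
      where
      lem : ∀ K a b c d → K *ᶻ (a -ᶻ b) +ᶻ (c -ᶻ d) ≡ (K *ᶻ a +ᶻ c) -ᶻ (K *ᶻ b +ᶻ d)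
      lem = ℤ-Solver.solve-∀

    abscissae-differ : ∀ {s t} → s ≢ t → proj₁ (z t) -ᶻ proj₁ (z s) ≢ 0ℤ
    abscissae-differ {s} {t} s≢t with proj₁ (S t) -ᶻ proj₁ (S s) ℤ.≟ 0ℤ
    ... | no dx≢0 = subst (_≢ 0ℤ) (difference s t)
          (proj₂ (dominate (proj₁ (S t) -ᶻ proj₁ (S s)) (proj₂ (S t) -ᶻ proj₂ (S s)) K dx≢0 (K-bound s t)))
    ... | yes dx≡0 = λ eq → s≢t (sym (proj₁ S-gp t s (cong₂ _,_
          (ℤₚ.i-j≡0⇒i≡j (proj₁ (S t)) (proj₁ (S s)) dx≡0)
          (ℤₚ.i-j≡0⇒i≡j (proj₂ (S t)) (proj₂ (S s)) (begin
            proj₂ (S t) -ᶻ proj₂ (S s)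
              ≡⟨ ℤₚ.+-identityˡ (proj₂ (S t) -ᶻ proj₂ (S s)) ⟨
            0ℤ +ᶻ (proj₂ (S t) -ᶻ proj₂ (S s))
              ≡⟨ cong (_+ᶻ (proj₂ (S t) -ᶻ proj₂ (S s))) (trans (cong (⁺ K *ᶻ_) dx≡0) (ℤₚ.*-zeroʳ (⁺ K))) ⟨
            ⁺ K *ᶻ (proj₁ (S t) -ᶻ proj₁ (S s)) +ᶻ (proj₂ (S t) -ᶻ proj₂ (S s))
              ≡⟨ trans (difference s t) eq ⟩
            0ℤ ∎)))))
      where open ≡-Reasoning

  lt-irrefl : ∀ s → lt s s ≡ false
  lt-irrefl s = cong pos (ℤₚ.+-inverseʳ (proj₁ (z s)))

  lt-connex : ∀ {s t} → s ≢ t → lt t s ≡ not (lt s t)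
  lt-connex {s} {t} s≢t = trans (cong pos (lem (proj₁ (z s)) (proj₁ (z t)))) (pos-neg _ (abscissae-differ s≢t))
    where
    lem : ∀ a b → a -ᶻ b ≡ -ᶻ (b -ᶻ a)
    lem = ℤ-Solver.solve-∀

  lt-trans : ∀ s t u → lt s t ≡ true → lt t u ≡ true → lt s u ≡ true
  lt-trans s t u st tu = pos-true (subst (0ℤ <ᶻ_) (lem (proj₁ (z s)) (proj₁ (z t)) (proj₁ (z u)))
    (ℤₚ.+-mono-< (pos-true⁻¹ (proj₁ (z t) -ᶻ proj₁ (z s)) st) (pos-true⁻¹ (proj₁ (z u) -ᶻ proj₁ (z t)) tu)))
    where
    lem : ∀ a b c → (b -ᶻ a) +ᶻ (c -ᶻ b) ≡ c -ᶻ a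
    lem = ℤ-Solver.solve-∀

  -- Two scales act in turn: `N` makes the direction of the short segment decisive, and `H` makes
  -- this direction that of the chosen line, up to the order of s and t.
  pair : ∀ {p q} s t u → p ≢ q → s ≢ t →
    SameSign (orient (point p s) (point p t) (point q u)) ((proj₁ (z t) -ᶻ proj₁ (z s)) *ᶻ orient (P p) (V p) (P q))
  pair {p} {q} s t u p≢q s≢t =
    subst (λ x → SameSign x A) (sym (orient-scale₂ (⁺ N) (P p) (P q) (e p s) (e p t) (e q u)))
      (SameSign-trans {z = A} (dominate _ (N-error₂ p s p t q u) N (proj₂ inner) (N-bound₂ p s p t q u)) inner)
    where
    A : ℤ
    A = (proj₁ (z t) -ᶻ proj₁ (z s)) *ᶻ orient (P p) (V p) (P q)
    inner : SameSign (cross (e p t ⊝ e p s) (P q ⊝ P p)) A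
    inner = subst (λ x → SameSign x A) (sym (cross-flat (⁺ H) (P p) (V p) (P q) (z s) (z t)))
      (dominate A (H-error p q s t) H (*≢0 _ _ (abscissae-differ s≢t) (line-generic p≢q)) (H-bound p q s t))

  pair-left : ∀ {p q} s t u → p ≢ q → ind (left (point p s) (point p t) (point q u)) ≡
    ind (left (P p) (V p) (P q)) * ind (lt s t) + ind (left (V p) (P p) (P q)) * ind (lt t s)
  pair-left {p} {q} s t u p≢q = byIndices (s ≟ t)
    where
    D D′ : Bool
    D = left (P p) (V p) (P q)
    D′ = left (V p) (P p) (P q)
    cases : ∀ b a → ind (if b then a else not a) ≡ ind b * ind a + ind (not b) * ind (not a)
    cases true  true  = refl
    cases true  false = refl
    cases false true  = refl
    cases false false = refl
    byIndices : ∀ {t} → Dec (s ≡ t) → ind (left (point p s) (point p t) (point q u)) ≡ ind D * ind (lt s t) + ind D′ * ind (lt t s)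
    byIndices (yes refl) = trans (cong ind (left-refl (point p s) (point q u)))
      (sym (cong₂ _+_ (trans (cong (λ b → ind D * ind b) (lt-irrefl s)) (ℕ.*-zeroʳ (ind D)))
                      (trans (cong (λ b → ind D′ * ind b) (lt-irrefl s)) (ℕ.*-zeroʳ (ind D′)))))
    byIndices {t} (no s≢t) = trans (cong ind (trans (proj₁ (pair s t u p≢q s≢t))
          (pos-* _ _ (abscissae-differ s≢t) (line-generic p≢q))))
        (trans (cases D (lt s t))
          (cong₂ (λ a b → ind D * ind (lt s t) + ind a * ind b)
            (sym (left-swap (P p) (V p) (P q) (line-generic p≢q))) (sym (lt-connex s≢t))))

  private
    otherIndex : ∀ p → ∃ λ q → p ≢ q
    otherIndex p with q , p≢q , _ ← thirdIndex 3≤m p p = q , p≢q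

    norm-positive : ∀ p → 0ℤ <ᶻ dot (V p ⊝ P p) (V p ⊝ P p)
    norm-positive p with q , p≢q ← otherIndex p =
      dot-positive (V p ⊝ P p) (λ v≡0 → line-generic p≢q (orient-zero (P p) (V p) (P q) v≡0))

  cluster : ∀ p s t u → orient (point p s) (point p t) (point p u) ≡
    ⁺ H *ᶻ (dot (V p ⊝ P p) (V p ⊝ P p) *ᶻ (⁺ K *ᶻ orient (S s) (S t) (S u)))
  cluster p s t u = trans (orient-translate ((⁺ N) ∙ P p) (e p s) (e p t) (e p u))
    (trans (orient-flat (⁺ H) (V p ⊝ P p) (z s) (z t) (z u))
      (cong (λ x → ⁺ H *ᶻ (dot (V p ⊝ P p) (V p ⊝ P p) *ᶻ x)) (orient-shear (⁺ K) (S s) (S t) (S u))))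

  cluster-left : ∀ p s t u → left (point p s) (point p t) (point p u) ≡ left (S s) (S t) (S u)
  cluster-left p s t u = trans (cong pos (cluster p s t u))
    (trans (pos-scale (⁺ H) (dot (V p ⊝ P p) (V p ⊝ P p) *ᶻ (⁺ K *ᶻ orient (S s) (S t) (S u))) (+<+ (s≤s z≤n)))
    (trans (pos-scale (dot (V p ⊝ P p) (V p ⊝ P p)) (⁺ K *ᶻ orient (S s) (S t) (S u)) (norm-positive p))
      (pos-scale (⁺ K) (orient (S s) (S t) (S u)) (+<+ (s≤s z≤n)))))

  cluster-≢0 : ∀ p {s t u} → s ≢ t → t ≢ u → s ≢ u → orient (point p s) (point p t) (point p u) ≢ 0ℤ
  cluster-≢0 p {s} {t} {u} s≢t t≢u s≢u = subst (_≢ 0ℤ) (sym (cluster p s t u))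
    (*≢0 (⁺ H) _ (λ ()) (*≢0 _ _ (0<-≢ (norm-positive p)) (*≢0 (⁺ K) _ (λ ()) (proj₂ S-gp s t u s≢t t≢u s≢u))))

  noncollinear : ∀ p s q t r u → (p , s) ≢ (q , t) → (q , t) ≢ (r , u) → (p , s) ≢ (r , u) →
    orient (point p s) (point q t) (point r u) ≢ 0ℤ
  noncollinear p s q t r u ps≢qt qt≢ru ps≢ru = byClusters (p ≟ q) (q ≟ r) (p ≟ r) ps≢qt qt≢ru ps≢ru
    where
    byClusters : ∀ {p q r} → Dec (p ≡ q) → Dec (q ≡ r) → Dec (p ≡ r) →
      (p , s) ≢ (q , t) → (q , t) ≢ (r , u) → (p , s) ≢ (r , u) → orient (point p s) (point q t) (point r u) ≢ 0ℤ
    byClusters {p} (yes refl) (yes refl) _ ps≢pt pt≢pu ps≢pu =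
      cluster-≢0 p (λ { refl → ps≢pt refl }) (λ { refl → pt≢pu refl }) (λ { refl → ps≢pu refl })
    byClusters (yes refl) (no p≢r) _ ps≢pt _ _ = proj₂ (pair s t u p≢r (λ { refl → ps≢pt refl }))
    -- `pair` expects the two points of a common cluster in front; here and in the next case a
    -- rotation brings them there.
    byClusters {p} {q} (no p≢q) (yes refl) _ _ qt≢qu _ =
      subst (_≢ 0ℤ) (sym (orient-rotate (point p s) (point q t) (point q u)))
        (proj₂ (pair t u s (λ q≡p → p≢q (sym q≡p)) (λ { refl → qt≢qu refl })))
    byClusters {p} {q} (no p≢q) (no _) (yes refl) _ _ ps≢pu =
      subst (_≢ 0ℤ) (orient-rotate (point p u) (point p s) (point q t))
        (proj₂ (pair u s t p≢q (λ { refl → ps≢pu refl })))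
    byClusters (no p≢q) (no q≢r) (no p≢r) _ _ _ = proj₂ (apart s t u p≢q q≢r p≢r)

  config : Config (m * k)
  config i = uncurry point (remQuot k i)

  config-combine : ∀ p s → config (combine p s) ≡ point p s
  config-combine p s = cong (uncurry point) (remQuot-combine p s)

  config-generalPosition : 3 ≤ m * k → GeneralPosition config
  config-generalPosition 3≤mk = noncollinear⇒generalPosition 3≤mk config λ i j l i≢j j≢l i≢l →
    noncollinear _ _ _ _ _ _ (λ eq → i≢j (remQuot-injective i j eq))
      (λ eq → j≢l (remQuot-injective j l eq)) (λ eq → i≢l (remQuot-injective i l eq))
    where
    remQuot-injective : ∀ (i j : Fin (m * k)) → remQuot {m} k i ≡ remQuot {m} k j → i ≡ j
    remQuot-injective i j eq = trans (sym (combine-remQuot {m} k i)) (trans (cong (uncurry combine) eq) (combine-remQuot {m} k j))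

  module _ (h : ℕ)
    (halving : ∀ p → sum (λ q → ind (left (P p) (V p) (P q))) ≡ h)
    (halving′ : ∀ p → sum (λ q → ind (left (V p) (P p) (P q))) ≡ h) where

    private
      module B = BlowUp {m} {k} h
        (λ p s q t r u → left (point p s) (point q t) (point r u))
        (λ p q r → left (P p) (P q) (P r)) (λ s t u → left (S s) (S t) (S u))
        (λ p q → left (P p) (V p) (P q)) (λ p q → left (V p) (P p) (P q)) lt
        (λ s t u p≢q q≢r p≢r → proj₁ (apart s t u p≢q q≢r p≢r))
        pair-left cluster-left
        (λ p s q t r u → left-rotate (point p s) (point q t) (point r u))
        (λ p q → left-aba (P p) (P q)) (λ p q → left-abb (P p) (P q)) (λ p q → left-refl (P p) (P q))
        (λ s t → left-refl (S s) (S t))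
        (λ p → left-aba (P p) (V p)) (λ p → left-abb (V p) (P p))
        (λ {p} {q} p≢q → trans (cong (λ b → ind (left (P p) (V p) (P q)) + ind b)
          (left-swap (P p) (V p) (P q) (line-generic p≢q))) (ind-not (left (P p) (V p) (P q))))
        halving halving′ lt-irrefl lt-connex lt-trans

      lefts-config : ∀ p s q t → lefts config (combine p s) (combine q t) ≡ B.L p s q t
      lefts-config p s q t = trans (∑-combine m {k} (λ l → ind (left (config (combine p s)) (config (combine q t)) (config l))))
        (sum-cong-≗ λ r → sum-cong-≗ λ u → cong ind (left-cong (config-combine p s) (config-combine q t) (config-combine r u)))
        where
        left-cong : ∀ {a a′ b b′ c c′} → a ≡ a′ → b ≡ b′ → c ≡ c′ → left a b c ≡ left a′ b′ c′
        left-cong refl refl refl = refl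

    separations-config : ∀ {m₁ m₂} → m ∸ 1 ≡ m₁ → m ∸ 2 ≡ m₂ → separations config ≡
      k * k * (k * k) * separations P
      + m * m₁ * (k * m₂ * (2 * k * (k C 2)) + (2 * k * (k C 3) + 2 * (k C 2) * (k C 2)))
      + m * (separations S + 2 * (k C 2) * (k * h * (k ∸ 2) + k * h * (k * h)))
    separations-config refl refl = begin
      separations config
        ≡⟨ trans (∑-combine m {k} (λ i → sum (λ j → lefts config i j * lefts config j i)))
             (sum-cong-≗ λ p → sum-cong-≗ λ s → trans
               (∑-combine m {k} (λ j → lefts config (combine p s) j * lefts config j (combine p s)))
               (sum-cong-≗ λ q → sum-cong-≗ λ t → cong₂ _*_ (lefts-config p s q t) (lefts-config q t p s))) ⟩
      sum (λ p → sum (λ s → sum (λ q → sum (λ t → B.L p s q t * B.L q t p s))))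
        ≡⟨ B.pairs-total (λ s≢t → lefts-sum S S-gp s≢t) (λ p≢q → lefts-sum P P-gp p≢q) ⟩
      _ ∎
      where open ≡-Reasoning

-- Evaluation on the integer grid

GridPoint : Set
GridPoint = ℕ × ℕ

embed : GridPoint → Point
embed (x , y) = ⁺ x , ⁺ y

-- The positive and the negative part of the orientation determinant, so that
-- it can be evaluated with natural numbers only.
det⁺ det⁻ : GridPoint → GridPoint → GridPoint → ℕ
det⁺ (px , py) (qx , qy) (rx , ry) = qx * ry + qy * px + py * rx
det⁻ (px , py) (qx , qy) (rx , ry) = qx * py + px * ry + qy * rx

gridLeft : GridPoint → GridPoint → GridPoint → Bool
gridLeft p q r = does (det⁻ p q r ℕ.<? det⁺ p q r)

gridNoncollinear : GridPoint → GridPoint → GridPoint → Bool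
gridNoncollinear p q r = not (det⁻ p q r ≡ᵇ det⁺ p q r)

-- These sums and tests recurse on the vector itself, so that evaluating them for the base set needs
-- no access by index.
sumᵛ : {A : Set} → (A → ℕ) → Vec A n → ℕ
sumᵛ f []       = 0
sumᵛ f (x ∷ xs) = f x + sumᵛ f xs

allᵛ : {A : Set} → (A → Bool) → Vec A n → Bool
allᵛ f []       = true
allᵛ f (x ∷ xs) = f x ∧ allᵛ f xs

allPairs : {A : Set} → (A → A → Bool) → Vec A n → Bool
allPairs f []       = true
allPairs f (x ∷ xs) = allᵛ (f x) xs ∧ allPairs f xs

allTriples : {A : Set} → (A → A → A → Bool) → Vec A n → Bool
allTriples f []       = true
allTriples f (x ∷ xs) = allPairs (f x) xs ∧ allTriples f xs

gridLefts : Vec (GridPoint × GridPoint) n → GridPoint → GridPoint → ℕ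
gridLefts xs p q = sumᵛ (λ r → ind (gridLeft p q (proj₁ r))) xs

gridSeparations : Vec (GridPoint × GridPoint) n → ℕ
gridSeparations xs = sumᵛ (λ p → sumᵛ (λ q → gridLefts xs (proj₁ p) (proj₁ q) * gridLefts xs (proj₁ q) (proj₁ p)) xs) xs

orient-embed : ∀ p q r → orient (embed p) (embed q) (embed r) ≡ ⁺ det⁺ p q r -ᶻ ⁺ det⁻ p q r
orient-embed (px , py) (qx , qy) (rx , ry) = trans (lem (⁺ px) (⁺ py) (⁺ qx) (⁺ qy) (⁺ rx) (⁺ ry))
  (cong₂ _-ᶻ_ (cast qx ry qy px py rx) (cast qx py px ry qy rx))
  where
  lem : ∀ px py qx qy rx ry → (qx -ᶻ px) *ᶻ (ry -ᶻ py) -ᶻ (qy -ᶻ py) *ᶻ (rx -ᶻ px) ≡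
    (qx *ᶻ ry +ᶻ qy *ᶻ px +ᶻ py *ᶻ rx) -ᶻ (qx *ᶻ py +ᶻ px *ᶻ ry +ᶻ qy *ᶻ rx)
  lem = ℤ-Solver.solve-∀
  cast : ∀ a b c d e f → ⁺ a *ᶻ ⁺ b +ᶻ ⁺ c *ᶻ ⁺ d +ᶻ ⁺ e *ᶻ ⁺ f ≡ ⁺ (a * b + c * d + e * f)
  cast a b c d e f = cong₂ _+ᶻ_ (cong₂ _+ᶻ_ (sym (ℤₚ.pos-* a b)) (sym (ℤₚ.pos-* c d))) (sym (ℤₚ.pos-* e f))

pos-difference : ∀ a b → pos (⁺ a -ᶻ ⁺ b) ≡ does (b ℕ.<? a)
pos-difference a b = byDec (b ℕ.<? a)
  where
  byDec : (d : Dec (b < a)) → pos (⁺ a -ᶻ ⁺ b) ≡ does d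
  byDec (yes b<a) = pos-true (subst (_<ᶻ ⁺ a -ᶻ ⁺ b) (ℤₚ.+-inverseʳ (⁺ b)) (ℤₚ.+-monoˡ-< (-ᶻ (⁺ b)) (ℤ.+<+ b<a)))
  byDec (no b≮a)  = pos-false (ℤₚ.i≤j⇒i-j≤0 (ℤ.+≤+ (ℕ.≮⇒≥ b≮a)))

left-embed : ∀ p q r → left (embed p) (embed q) (embed r) ≡ gridLeft p q r
left-embed p q r = trans (cong pos (orient-embed p q r)) (pos-difference (det⁺ p q r) (det⁻ p q r))

T⇒≡ : ∀ {b} → IsTrue b → b ≡ true
T⇒≡ {true} _ = refl

noncollinear-embed : ∀ p q r → gridNoncollinear p q r ≡ true → orient (embed p) (embed q) (embed r) ≢ 0ℤ
noncollinear-embed p q r t orient≡0 with det⁻ p q r ≡ᵇ det⁺ p q r in e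
noncollinear-embed p q r () orient≡0 | true
noncollinear-embed p q r t  orient≡0 | false with () ← trans (sym e) (T⇒≡ (ℕ.≡⇒≡ᵇ (det⁻ p q r) (det⁺ p q r)
  (sym (ℤₚ.+-injective (ℤₚ.i-j≡0⇒i≡j (⁺ det⁺ p q r) (⁺ det⁻ p q r) (trans (sym (orient-embed p q r)) orient≡0))))))

sum-lookup : {A : Set} (f : A → ℕ) (xs : Vec A n) → sum (λ i → f (lookup xs i)) ≡ sumᵛ f xs
sum-lookup f []       = refl
sum-lookup f (x ∷ xs) = cong (f x +_) (sum-lookup f xs)

∧-true : ∀ {a b} → a ∧ b ≡ true → a ≡ true × b ≡ true
∧-true {true} {true} _ = refl , refl

allᵛ-lookup : {A : Set} (f : A → Bool) (xs : Vec A n) → allᵛ f xs ≡ true → ∀ i → f (lookup xs i) ≡ true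
allᵛ-lookup f (x ∷ xs) t zero    = proj₁ (∧-true t)
allᵛ-lookup f (x ∷ xs) t (suc i) = allᵛ-lookup f xs (proj₂ (∧-true t)) i

allPairs-lookup : {A : Set} (f : A → A → Bool) (xs : Vec A n) → allPairs f xs ≡ true →
  ∀ i j → i <ᶠ j → f (lookup xs i) (lookup xs j) ≡ true
allPairs-lookup f (x ∷ xs) t zero    (suc j) _       = allᵛ-lookup (f x) xs (proj₁ (∧-true t)) j
allPairs-lookup f (x ∷ xs) t (suc i) (suc j) (s≤s p) = allPairs-lookup f xs (proj₂ (∧-true t)) i j p

allTriples-lookup : {A : Set} (f : A → A → A → Bool) (xs : Vec A n) → allTriples f xs ≡ true →
  ∀ i j k → i <ᶠ j → j <ᶠ k → f (lookup xs i) (lookup xs j) (lookup xs k) ≡ true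
allTriples-lookup f (x ∷ xs) t zero    (suc j) (suc k) _       (s≤s q) = allPairs-lookup (f x) xs (proj₁ (∧-true t)) j k q
allTriples-lookup f (x ∷ xs) t (suc i) (suc j) (suc k) (s≤s p) (s≤s q) = allTriples-lookup f xs (proj₂ (∧-true t)) i j k p q

rotate-≢0 : ∀ {a b c} → orient a b c ≢ 0ℤ → orient b c a ≢ 0ℤ
rotate-≢0 {a} {b} {c} = subst (_≢ 0ℤ) (orient-rotate a b c)

swap-≢0 : ∀ {a b c} → orient a b c ≢ 0ℤ → orient b a c ≢ 0ℤ
swap-≢0 {a} {b} {c} abc≢0 bac≡0 = abc≢0 (trans (sym (ℤₚ.neg-involutive (orient a b c)))
  (cong -ᶻ_ (trans (sym (orient-swap a b c)) bac≡0)))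

-- A permutation of three points changes the determinant at most in sign, so increasing triples
-- suffice; the six cases are the six orders of i, j, k.
noncollinear-sorted : (P : Config n) → (∀ i j k → i <ᶠ j → j <ᶠ k → orient (P i) (P j) (P k) ≢ 0ℤ) →
  ∀ i j k → i ≢ j → j ≢ k → i ≢ k → orient (P i) (P j) (P k) ≢ 0ℤ
noncollinear-sorted {n} P sorted i j k i≢j j≢k i≢k with Fin.<-cmp i j | Fin.<-cmp j k | Fin.<-cmp i k
... | tri≈ _ i≡j _ | _ | _ = ⊥-elim (i≢j i≡j)
... | _ | tri≈ _ j≡k _ | _ = ⊥-elim (j≢k j≡k)
... | _ | _ | tri≈ _ i≡k _ = ⊥-elim (i≢k i≡k)
... | tri< i<j _ _ | tri< j<k _ _ | _            = sorted i j k i<j j<k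
... | tri< _ _ _   | tri> _ _ k<j | tri< i<k _ _ = rotate-≢0 {P k} {P i} {P j} (swap-≢0 {P i} {P k} {P j} (sorted i k j i<k k<j))
... | tri< i<j _ _ | tri> _ _ _   | tri> _ _ k<i = rotate-≢0 {P k} {P i} {P j} (sorted k i j k<i i<j)
... | tri> _ _ j<i | tri< _ _ _   | tri< i<k _ _ = swap-≢0 {P j} {P i} {P k} (sorted j i k j<i i<k)
... | tri> _ _ _   | tri< j<k _ _ | tri> _ _ k<i = rotate-≢0 {P k} {P i} {P j} (rotate-≢0 {P j} {P k} {P i} (sorted j k i j<k k<i))
... | tri> _ _ j<i | tri> _ _ k<j | _            = swap-≢0 {P j} {P i} {P k} (rotate-≢0 {P k} {P j} {P i} (sorted k j i k<j j<i))


does-≟ : ∀ m n → does (m ℕ.≟ n) ≡ true → m ≡ n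
does-≟ m n t = ℕ.≡ᵇ⇒≡ m n (subst IsTrue (sym t) _)

-- Tests both lines, because `allPairs` meets every pair in one order only.
linesMiss : GridPoint × GridPoint → GridPoint × GridPoint → Bool
linesMiss p q = gridNoncollinear (proj₁ p) (proj₂ p) (proj₁ q) ∧ gridNoncollinear (proj₁ q) (proj₂ q) (proj₁ p)

balanced : ℕ → Vec (GridPoint × GridPoint) n → GridPoint × GridPoint → Bool
balanced h xs p = does (gridLefts xs (proj₁ p) (proj₂ p) ℕ.≟ h) ∧ does (gridLefts xs (proj₂ p) (proj₁ p) ℕ.≟ h)

-- Each entry consists of a point and a second point on a line through it.
module Grid {n} (xs : Vec (GridPoint × GridPoint) n) where

  points partners : Config n
  points i = embed (proj₁ (lookup xs i))
  partners i = embed (proj₂ (lookup xs i))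

  points-generalPosition : 3 ≤ n →
    allTriples (λ p q r → gridNoncollinear (proj₁ p) (proj₁ q) (proj₁ r)) xs ≡ true → GeneralPosition points
  points-generalPosition 3≤n check = noncollinear⇒generalPosition 3≤n points
    (noncollinear-sorted points λ i j k i<j j<k →
      noncollinear-embed (proj₁ (lookup xs i)) (proj₁ (lookup xs j)) (proj₁ (lookup xs k))
      (allTriples-lookup (λ p q r → gridNoncollinear (proj₁ p) (proj₁ q) (proj₁ r)) xs check i j k i<j j<k))

  lines-generic : allPairs linesMiss xs ≡ true →
    ∀ {p q} → p ≢ q → orient (points p) (partners p) (points q) ≢ 0ℤ
  lines-generic check {p} {q} p≢q with Fin.<-cmp p q
  ... | tri< p<q _ _ = noncollinear-embed (proj₁ (lookup xs p)) (proj₂ (lookup xs p)) (proj₁ (lookup xs q))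
        (proj₁ (∧-true (allPairs-lookup linesMiss xs check p q p<q)))
  ... | tri≈ _ p≡q _ = ⊥-elim (p≢q p≡q)
  ... | tri> _ _ q<p = noncollinear-embed (proj₁ (lookup xs p)) (proj₂ (lookup xs p)) (proj₁ (lookup xs q))
        (proj₂ (∧-true {gridNoncollinear (proj₁ (lookup xs q)) (proj₂ (lookup xs q)) (proj₁ (lookup xs p))}
          (allPairs-lookup linesMiss xs check q p q<p)))

  lefts-embed : ∀ p q → sum (λ r → ind (left (embed p) (embed q) (points r))) ≡ gridLefts xs p q
  lefts-embed p q = trans (sum-cong-≗ λ r → cong ind (left-embed p q (proj₁ (lookup xs r))))
    (sum-lookup (λ r → ind (gridLeft p q (proj₁ r))) xs)

  points-separations : separations points ≡ gridSeparations xs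
  points-separations = trans (sum-cong-≗ λ i → trans
      (sum-cong-≗ λ j → cong₂ _*_ (lefts-embed (proj₁ (lookup xs i)) (proj₁ (lookup xs j)))
                                  (lefts-embed (proj₁ (lookup xs j)) (proj₁ (lookup xs i))))
      (sum-lookup (λ q → gridLefts xs (proj₁ (lookup xs i)) (proj₁ q) * gridLefts xs (proj₁ q) (proj₁ (lookup xs i))) xs))
    (sum-lookup (λ p → sumᵛ (λ q → gridLefts xs (proj₁ p) (proj₁ q) * gridLefts xs (proj₁ q) (proj₁ p)) xs) xs)

  module _ (h : ℕ) (check : allᵛ (balanced h xs) xs ≡ true) where

    halving : ∀ p → sum (λ q → ind (left (points p) (partners p) (points q))) ≡ h
    halving p = trans (lefts-embed (proj₁ (lookup xs p)) (proj₂ (lookup xs p)))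
      (does-≟ _ h (proj₁ (∧-true (allᵛ-lookup (balanced h xs) xs check p))))

    halving′ : ∀ p → sum (λ q → ind (left (partners p) (points p) (points q))) ≡ h
    halving′ p = trans (lefts-embed (proj₂ (lookup xs p)) (proj₁ (lookup xs p)))
      (does-≟ _ h (proj₂ (∧-true {does (gridLefts xs (proj₁ (lookup xs p)) (proj₂ (lookup xs p)) ℕ.≟ h)}
        (allᵛ-lookup (balanced h xs) xs check p))))

-- A 75-point set with 450510 crossings, found by simulated annealing, where
-- each point is listed with a second point on a line through it that has 37
-- of the other points on each side.
base : Vec (GridPoint × GridPoint) 75
base =
  ((74470 , 54784) , (74468 , 54785)) ∷ ((74713 , 54565) , (74709 , 54568)) ∷ ((91485 , 48084) , (91472 , 48086)) ∷
  ((4416 , 3377) , (4454 , 3406)) ∷ ((26439 , 20239) , (26452 , 20249)) ∷ ((67163 , 57918) , (67170 , 57927)) ∷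
  ((73194 , 75942) , (73194 , 75943)) ∷ ((69758 , 51567) , (69771 , 51576)) ∷ ((73196 , 76075) , (73197 , 76090)) ∷
  ((74740 , 54545) , (74737 , 54547)) ∷ ((73604 , 80479) , (73609 , 80497)) ∷ ((52849 , 41752) , (52872 , 41773)) ∷
  ((96604 , 46105) , (96589 , 46109)) ∷ ((3132 , 2393) , (3179 , 2429)) ∷ ((64141 , 47589) , (64144 , 47590)) ∷
  ((71681 , 63661) , (71687 , 63698)) ∷ ((51795 , 40873) , (51809 , 40886)) ∷ ((41950 , 31746) , (41961 , 31754)) ∷
  ((122046 , 38343) , (122033 , 38347)) ∷ ((31242 , 23815) , (31246 , 23818)) ∷ ((106676 , 43097) , (106657 , 43103)) ∷
  ((99026 , 45499) , (99003 , 45507)) ∷ ((96401 , 46152) , (96384 , 46156)) ∷ ((96338 , 46166) , (96331 , 46168)) ∷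
  ((70505 , 56523) , (70496 , 56527)) ∷ ((67262 , 58029) , (67263 , 58032)) ∷ ((67481 , 58492) , (67485 , 58501)) ∷
  ((73962 , 81744) , (73964 , 81759)) ∷ ((118669 , 39382) , (118640 , 39391)) ∷ ((101807 , 44543) , (101797 , 44546)) ∷
  ((64128 , 47588) , (64137 , 47590)) ∷ ((46104 , 35594) , (46105 , 35595)) ∷ ((70479 , 56534) , (70472 , 56537)) ∷
  ((45971 , 35464) , (45986 , 35478)) ∷ ((67501 , 58538) , (67503 , 58543)) ∷ ((41567 , 31468) , (41585 , 31481)) ∷
  ((80294 , 49440) , (80273 , 49442)) ∷ ((75941 , 88842) , (75945 , 88861)) ∷ ((119653 , 39082) , (119617 , 39093)) ∷
  ((74457 , 54895) , (74456 , 54897)) ∷ ((58385 , 46364) , (58422 , 46395)) ∷ ((81173 , 49264) , (81160 , 49265)) ∷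
  ((90300 , 48547) , (90292 , 48550)) ∷ ((83703 , 122046) , (83707 , 122063)) ∷ ((98231 , 45770) , (98228 , 45771)) ∷
  ((78949 , 101922) , (78955 , 101947)) ∷ ((76547 , 91870) , (76555 , 91901)) ∷ ((75894 , 88592) , (75898 , 88613)) ∷
  ((75880 , 88515) , (75882 , 88524)) ∷ ((65523 , 52326) , (65527 , 52339)) ∷ ((64017 , 47576) , (64020 , 47578)) ∷
  ((63554 , 47333) , (63561 , 47337)) ∷ ((40302 , 30561) , (40317 , 30574)) ∷ ((82664 , 117630) , (82673 , 117668)) ∷
  ((77503 , 95607) , (77506 , 95620)) ∷ ((74458 , 54883) , (74456 , 54890)) ∷ ((86452 , 48852) , (86451 , 48852)) ∷
  ((65512 , 52288) , (65515 , 52298)) ∷ ((86582 , 48850) , (86568 , 48851)) ∷ ((63508 , 47306) , (63510 , 47307)) ∷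
  ((90578 , 48442) , (90565 , 48447)) ∷ ((72606 , 69197) , (72608 , 69220)) ∷ ((33204 , 25442) , (33223 , 25457)) ∷
  ((82964 , 118914) , (82975 , 118961)) ∷ ((67151 , 57905) , (67153 , 57908)) ∷ ((75682 , 50365) , (75651 , 50371)) ∷
  ((72782 , 70251) , (72783 , 70265)) ∷ ((73499 , 80096) , (73502 , 80107)) ∷ ((0 , 0) , (17 , 13)) ∷
  ((76276 , 90804) , (76277 , 90808)) ∷ ((20124 , 15370) , (20149 , 15389)) ∷ ((30176 , 23020) , (30207 , 23043)) ∷
  ((33454 , 25645) , (33475 , 25662)) ∷ ((33531 , 25708) , (33540 , 25715)) ∷ ((69720 , 51541) , (69709 , 51543)) ∷ []

base-generalPosition : GeneralPosition (Grid.points base)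
base-generalPosition = Grid.points-generalPosition base (s≤s (s≤s (s≤s z≤n))) refl

base-lines : allPairs linesMiss base ≡ true
base-lines = refl

base-balanced : allᵛ (balanced 37 base) base ≡ true
base-balanced = refl

-- The value encodes the 450510 crossings: 6 C(75,4) - 2 · 450510 = 7292700 - 901020. It is
-- confirmed by evaluation.
gridSeparations-base : gridSeparations base ≡ 6391680
gridSeparations-base = refl

base-separations : separations (Grid.points base) ≡ 6391680
base-separations = trans (Grid.points-separations base) gridSeparations-base

-- The recursion and its limit

sum-inject≤ : ∀ {N} (n≤N : n ≤ N) (f : Fin N → ℕ) → sum (λ i → f (inject≤ i n≤N)) ≤ sum f
sum-inject≤ {zero}          _   f = z≤n
sum-inject≤ {suc n} {suc N} n≤N f = ℕ.+-monoʳ-≤ (f zero) (sum-inject≤ (s≤s⁻¹ n≤N) (λ i → f (suc i)))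

sum₂-inject≤ : ∀ {N} (n≤N : n ≤ N) (f : Fin N → Fin N → ℕ) →
  sum₂ (λ i j → f (inject≤ i n≤N) (inject≤ j n≤N)) ≤ sum₂ f
sum₂-inject≤ {zero}          _   f = z≤n
sum₂-inject≤ {suc n} {suc N} n≤N f = ℕ.+-mono-≤ (sum-inject≤ (s≤s⁻¹ n≤N) (λ j → f zero (suc j)))
  (sum₂-inject≤ (s≤s⁻¹ n≤N) (λ i j → f (suc i) (suc j)))

sum₃-inject≤ : ∀ {N} (n≤N : n ≤ N) (f : Fin N → Fin N → Fin N → ℕ) →
  sum₃ (λ i j k → f (inject≤ i n≤N) (inject≤ j n≤N) (inject≤ k n≤N)) ≤ sum₃ f
sum₃-inject≤ {zero}          _   f = z≤n
sum₃-inject≤ {suc n} {suc N} n≤N f = ℕ.+-mono-≤ (sum₂-inject≤ (s≤s⁻¹ n≤N) (λ j k → f zero (suc j) (suc k)))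
  (sum₃-inject≤ (s≤s⁻¹ n≤N) (λ i j k → f (suc i) (suc j) (suc k)))

sum₄-inject≤ : ∀ {N} (n≤N : n ≤ N) (f : Fin N → Fin N → Fin N → Fin N → ℕ) →
  sum₄ (λ i j k l → f (inject≤ i n≤N) (inject≤ j n≤N) (inject≤ k n≤N) (inject≤ l n≤N)) ≤ sum₄ f
sum₄-inject≤ {zero}          _   f = z≤n
sum₄-inject≤ {suc n} {suc N} n≤N f = ℕ.+-mono-≤ (sum₃-inject≤ (s≤s⁻¹ n≤N) (λ j k l → f zero (suc j) (suc k) (suc l)))
  (sum₄-inject≤ (s≤s⁻¹ n≤N) (λ i j k l → f (suc i) (suc j) (suc k) (suc l)))

restrict : ∀ {N} → n ≤ N → Config N → Config n
restrict n≤N P i = P (inject≤ i n≤N)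

restrict-generalPosition : ∀ {N} (n≤N : n ≤ N) (P : Config N) → GeneralPosition P → GeneralPosition (restrict n≤N P)
restrict-generalPosition n≤N P (injective , noncollinear) =
    (λ i j e → inject≤-injective n≤N n≤N i j (injective _ _ e))
  , (λ i j k i≢j j≢k i≢k → noncollinear _ _ _ (λ e → i≢j (inject≤-injective n≤N n≤N i j e))
      (λ e → j≢k (inject≤-injective n≤N n≤N j k e)) (λ e → i≢k (inject≤-injective n≤N n≤N i k e)))

-- Only the first n points are kept; their increasing quadruples are among those of P.
restrict-crossings : ∀ {N} (n≤N : n ≤ N) (P : Config N) → crossings (restrict n≤N P) ≤ crossings P
restrict-crossings n≤N P = subst₂ _≤_ (sym (crossings≡sum₄ (restrict n≤N P))) (sym (crossings≡sum₄ P))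
  (sum₄-inject≤ n≤N (λ i j k l → ind (convex4 (P i) (P j) (P k) (P l))))

-- Binomial coefficients as polynomials, with the negative terms moved across

2*nC2 : ∀ n → 2 * (n C 2) + n ≡ n * n
2*nC2 zero    = refl
2*nC2 (suc n) = begin
  2 * (suc n C 2) + suc n
    ≡⟨ cong (λ c → 2 * c + suc n) (trans (sym (nCk+nC[k+1]≡[n+1]C[k+1] n 1)) (cong (_+ n C 2) (nC1≡n n))) ⟩
  2 * (n + n C 2) + suc n
    ≡⟨ before n (n C 2) ⟩
  (2 * (n C 2) + n) + (n + n + 1)
    ≡⟨ cong (_+ (n + n + 1)) (2*nC2 n) ⟩
  n * n + (n + n + 1)
    ≡⟨ after n ⟩
  suc n * suc n ∎
  where
  open ≡-Reasoning
  before : ∀ n c → 2 * (n + c) + (1 + n) ≡ (2 * c + n) + (n + n + 1)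
  before = solve-∀
  after : ∀ n → n * n + (n + n + 1) ≡ (1 + n) * (1 + n)
  after = solve-∀

6*nC3 : ∀ n → 6 * (n C 3) + 3 * (n * n) ≡ n * n * n + 2 * n
6*nC3 zero    = refl
6*nC3 (suc n) = begin
  6 * (suc n C 3) + 3 * (suc n * suc n)
    ≡⟨ cong (λ c → 6 * c + 3 * (suc n * suc n)) (nCk+nC[k+1]≡[n+1]C[k+1] n 2) ⟨
  6 * (n C 2 + n C 3) + 3 * (suc n * suc n)
    ≡⟨ before n (n C 2) (n C 3) ⟩
  3 * (2 * (n C 2) + n) + (6 * (n C 3) + 3 * (n * n)) + (3 * n + 3)
    ≡⟨ cong₂ (λ a b → 3 * a + b + (3 * n + 3)) (2*nC2 n) (6*nC3 n) ⟩
  3 * (n * n) + (n * n * n + 2 * n) + (3 * n + 3)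
    ≡⟨ after n ⟩
  suc n * suc n * suc n + 2 * suc n ∎
  where
  open ≡-Reasoning
  before : ∀ n c d → 6 * (c + d) + 3 * ((1 + n) * (1 + n)) ≡ 3 * (2 * c + n) + (6 * d + 3 * (n * n)) + (3 * n + 3)
  before = solve-∀
  after : ∀ n → 3 * (n * n) + (n * n * n + 2 * n) + (3 * n + 3) ≡ (1 + n) * (1 + n) * (1 + n) + 2 * (1 + n)
  after = solve-∀

24*nC4 : ∀ n → 24 * (n C 4) + 6 * (n * n * n) + 6 * n ≡ n * n * n * n + 11 * (n * n)
24*nC4 zero    = refl
24*nC4 (suc n) = begin
  24 * (suc n C 4) + 6 * (suc n * suc n * suc n) + 6 * suc n
    ≡⟨ cong (λ c → 24 * c + 6 * (suc n * suc n * suc n) + 6 * suc n) (nCk+nC[k+1]≡[n+1]C[k+1] n 3) ⟨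
  24 * (n C 3 + n C 4) + 6 * (suc n * suc n * suc n) + 6 * suc n
    ≡⟨ before n (n C 3) (n C 4) ⟩
  4 * (6 * (n C 3) + 3 * (n * n)) + (24 * (n C 4) + 6 * (n * n * n) + 6 * n) + (6 * (n * n) + 18 * n + 12)
    ≡⟨ cong₂ (λ a b → 4 * a + b + (6 * (n * n) + 18 * n + 12)) (6*nC3 n) (24*nC4 n) ⟩
  4 * (n * n * n + 2 * n) + (n * n * n * n + 11 * (n * n)) + (6 * (n * n) + 18 * n + 12)
    ≡⟨ after n ⟩
  suc n * suc n * suc n * suc n + 11 * (suc n * suc n) ∎
  where
  open ≡-Reasoning
  before : ∀ n c d → 24 * (c + d) + 6 * ((1 + n) * (1 + n) * (1 + n)) + 6 * (1 + n) ≡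
    4 * (6 * c + 3 * (n * n)) + (24 * d + 6 * (n * n * n) + 6 * n) + (6 * (n * n) + 18 * n + 12)
  before = solve-∀
  after : ∀ n → 4 * (n * n * n + 2 * n) + (n * n * n * n + 11 * (n * n)) + (6 * (n * n) + 18 * n + 12) ≡
    (1 + n) * (1 + n) * (1 + n) * (1 + n) + 11 * ((1 + n) * (1 + n))
  after = solve-∀

-- Choosing a pair and then a third element meets each triple three times. Truncation is harmless,
-- as C(n,2) = 0 for n < 2.
nC2*[n∸2] : ∀ n → (n C 2) * (n ∸ 2) ≡ 3 * (n C 3)
nC2*[n∸2] zero          = refl
nC2*[n∸2] (suc zero)    = refl
nC2*[n∸2] (suc (suc n)) = ℕ.*-cancelˡ-≡ _ _ 2 (ℕ.+-cancelʳ-≡ (N * n + 3 * (N * N)) _ _ (begin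
  2 * ((N C 2) * n) + (N * n + 3 * (N * N))
    ≡⟨ before n N (N C 2) ⟩
  (2 * (N C 2) + N) * n + 3 * (N * N)
    ≡⟨ cong (λ a → a * n + 3 * (N * N)) (2*nC2 N) ⟩
  N * N * n + 3 * (N * N)
    ≡⟨ middle n ⟩
  N * N * N + 2 * N + N * n
    ≡⟨ cong (_+ N * n) (6*nC3 N) ⟨
  6 * (N C 3) + 3 * (N * N) + N * n
    ≡⟨ after (N C 3) (3 * (N * N)) (N * n) ⟩
  2 * (3 * (N C 3)) + (N * n + 3 * (N * N)) ∎))
  where
  open ≡-Reasoning
  N : ℕ
  N = suc (suc n)
  before : ∀ n N c → 2 * (c * n) + (N * n + 3 * (N * N)) ≡ (2 * c + N) * n + 3 * (N * N)
  before = solve-∀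
  middle : ∀ n → (2 + n) * (2 + n) * n + 3 * ((2 + n) * (2 + n)) ≡ (2 + n) * (2 + n) * (2 + n) + 2 * (2 + n) + (2 + n) * n
  middle = solve-∀
  after : ∀ a b c → 6 * a + b + c ≡ 2 * (3 * a) + (c + b)
  after = solve-∀

-- For g = C(k,2), t = C(k,3), d = k ∸ 2: the part of the new `separations` that depends only on k.
-- The factor 12 comes from 24 cr = 12 · 2 cr, and the value is 6182700 k⁴ - 6327000 k³ + 144300 k².
composite-separations : ∀ k g t d → 2 * g + k ≡ k * k → 6 * t + 3 * (k * k) ≡ k * k * k + 2 * k → g * d ≡ 3 * t →
  12 * (75 * 74 * (k * 73 * (2 * k * g) + (2 * k * t + 2 * g * g)) + 75 * (2 * g * (k * 37 * d + k * 37 * (k * 37))))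
    + k * k * k * 6327000 ≡ k * k * k * k * 6182700 + k * k * 144300
composite-separations k g t d 2g 6t gd = begin
  12 * (75 * 74 * (k * 73 * (2 * k * g) + (2 * k * t + 2 * g * g)) + 75 * (2 * g * (k * 37 * d + k * 37 * (k * 37)))) + k * k * k * 6327000
    ≡⟨ s₁ k g t d ⟩
  s (k * k) (g * d)
    -- One k² inside a cubic term is turned back into 2 g + k. This supplies the summands missing
    -- from a polynomial in 2 g + k and 6 t + 3 k².
    ≡⟨ cong₂ s (sym 2g) gd ⟩
  s (2 * g + k) (3 * t)
    ≡⟨ s₂ k g t ⟩
  k * k * (2 * g + k) * 6093900 + k * (6 * t + 3 * (k * k)) * 55500 + ((2 * g + k) * (2 * g + k) + k * k) * 33300
    ≡⟨ cong₂ (λ u w → k * k * u * 6093900 + k * w * 55500 + (u * u + k * k) * 33300) 2g 6t ⟩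
  k * k * (k * k) * 6093900 + k * (k * k * k + 2 * k) * 55500 + (k * k * (k * k) + k * k) * 33300
    ≡⟨ s₃ k ⟩
  k * k * k * k * 6182700 + k * k * 144300 ∎
  where
  open ≡-Reasoning
  s : ℕ → ℕ → ℕ
  s k² gd = k * k * (2 * g) * 6093900 + k * t * 133200 + k * gd * 66600 + g * g * 133200
    + k * k * k * 6260400 + k * k² * 66600
  s₁ : ∀ k g t d → 12 * (75 * 74 * (k * 73 * (2 * k * g) + (2 * k * t + 2 * g * g)) + 75 * (2 * g * (k * 37 * d + k * 37 * (k * 37)))) + k * k * k * 6327000 ≡
    k * k * (2 * g) * 6093900 + k * t * 133200 + k * (g * d) * 66600 + g * g * 133200 + k * k * k * 6260400 + k * (k * k) * 66600
  s₁ = solve-∀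
  s₂ : ∀ k g t → k * k * (2 * g) * 6093900 + k * t * 133200 + k * (3 * t) * 66600 + g * g * 133200 + k * k * k * 6260400 + k * (2 * g + k) * 66600 ≡
    k * k * (2 * g + k) * 6093900 + k * (6 * t + 3 * (k * k)) * 55500 + ((2 * g + k) * (2 * g + k) + k * k) * 33300
  s₂ = solve-∀
  s₃ : ∀ k → k * k * (k * k) * 6093900 + k * (k * k * k + 2 * k) * 55500 + (k * k * (k * k) + k * k) * 33300 ≡
    k * k * k * k * 6182700 + k * k * 144300
  s₃ = solve-∀

-- The six equations are added up with the multiples for which everything
-- except c, q and the powers of k cancels.
composite-sum : ∀ k c q zˢ zᴾ zQ f F A → let n = 75 * k in
  2 * c + zˢ ≡ 6 * f → 2 * q + zQ ≡ 6 * F →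
  24 * f + 6 * (k * k * k) + 6 * k ≡ k * k * k * k + 11 * (k * k) →
  24 * F + 6 * (n * n * n) + 6 * n ≡ n * n * n * n + 11 * (n * n) →
  12 * zQ ≡ k * k * k * k * zᴾ * 12 + 12 * A + 900 * zˢ →
  12 * A + k * k * k * 6327000 ≡ k * k * k * k * 6182700 + k * k * 144300 →
  24 * q + k * k * k * 1265400 + k * k * k * k * zᴾ * 12 ≡ k * k * k * k * 88738950 + k * k * 38850 + c * 1800
composite-sum k c q zˢ zᴾ zQ f F A e₁ e₂ e₃ e₄ e₅ e₆ =
  ℕ.+-cancelʳ-≡ (W k zˢ zQ f F A) _ _ (begin
    24 * q + k * k * k * 1265400 + k * k * k * k * zᴾ * 12 + W k zˢ zQ f F A
      ≡⟨ left-sum k q zˢ zᴾ zQ f F A ⟩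
    12 * (2 * q + zQ) + (k * k * k * k * zᴾ * 12 + 12 * A + 900 * zˢ)
      + 3 * (24 * F + 6 * (75 * k * (75 * k) * (75 * k)) + 6 * (75 * k))
      + (k * k * k * k * 6182700 + k * k * 144300) + 900 * (6 * f) + 225 * (k * k * k * k + 11 * (k * k))
      ≡⟨ cong₆ e₂ (sym e₅) e₄ (sym e₆) (sym e₁) (sym e₃) ⟩
    12 * (6 * F) + 12 * zQ + 3 * (75 * k * (75 * k) * (75 * k) * (75 * k) + 11 * (75 * k * (75 * k)))
      + (12 * A + k * k * k * 6327000) + 900 * (2 * c + zˢ) + 225 * (24 * f + 6 * (k * k * k) + 6 * k)
      ≡⟨ right-sum k c zˢ zQ f F A ⟩
    k * k * k * k * 88738950 + k * k * 38850 + c * 1800 + W k zˢ zQ f F A ∎)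
  where
  open ≡-Reasoning
  W : ℕ → ℕ → ℕ → ℕ → ℕ → ℕ → ℕ
  W k zˢ zQ f F A = 12 * zQ + 12 * A + 900 * zˢ + 72 * F + 5400 * f
    + k * k * k * 6328350 + k * 1350 + k * k * k * k * 6182925 + k * k * 146775
  cong₆ : ∀ {a a′ b b′ c c′ d d′ e e′ f f′} → a ≡ a′ → b ≡ b′ → c ≡ c′ → d ≡ d′ → e ≡ e′ → f ≡ f′ →
    12 * a + b + 3 * c + d + 900 * e + 225 * f ≡ 12 * a′ + b′ + 3 * c′ + d′ + 900 * e′ + 225 * f′
  cong₆ refl refl refl refl refl refl = refl
  left-sum : ∀ k q zˢ zᴾ zQ f F A →
    24 * q + k * k * k * 1265400 + k * k * k * k * zᴾ * 12 + (12 * zQ + 12 * A + 900 * zˢ + 72 * F + 5400 * f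
      + k * k * k * 6328350 + k * 1350 + k * k * k * k * 6182925 + k * k * 146775) ≡
    12 * (2 * q + zQ) + (k * k * k * k * zᴾ * 12 + 12 * A + 900 * zˢ)
      + 3 * (24 * F + 6 * (75 * k * (75 * k) * (75 * k)) + 6 * (75 * k))
      + (k * k * k * k * 6182700 + k * k * 144300) + 900 * (6 * f) + 225 * (k * k * k * k + 11 * (k * k))
  left-sum = solve-∀
  right-sum : ∀ k c zˢ zQ f F A →
    12 * (6 * F) + 12 * zQ + 3 * (75 * k * (75 * k) * (75 * k) * (75 * k) + 11 * (75 * k * (75 * k)))
      + (12 * A + k * k * k * 6327000) + 900 * (2 * c + zˢ) + 225 * (24 * f + 6 * (k * k * k) + 6 * k) ≡
    k * k * k * k * 88738950 + k * k * 38850 + c * 1800 + (12 * zQ + 12 * A + 900 * zˢ + 72 * F + 5400 * f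
      + k * k * k * 6328350 + k * 1350 + k * k * k * k * 6182925 + k * k * 146775)
  right-sum = solve-∀

n²≤n³ : ∀ n → n * n ≤ n * n * n
n²≤n³ zero    = z≤n
n²≤n³ (suc n) = ℕ.m≤m*n (suc n * suc n) (suc n)

-- The size m and its predecessors m₁ and m₂ are kept as variables until the
-- base set is substituted, lest the sums over Fin m be evaluated.
blowUp : ∀ {m m₁ m₂} h z (xs : Vec (GridPoint × GridPoint) m) → m ∸ 1 ≡ m₁ → m ∸ 2 ≡ m₂ → 3 ≤ m →
  GeneralPosition (Grid.points xs) → allPairs linesMiss xs ≡ true → allᵛ (balanced h xs) xs ≡ true →
  separations (Grid.points xs) ≡ z →
  ∀ {k} (S : Config k) → GeneralPosition S → 1 ≤ k →
  Σ (Config (m * k)) λ Q → GeneralPosition Q × separations Q ≡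
    k * k * (k * k) * z
    + m * m₁ * (k * m₂ * (2 * k * (k C 2)) + (2 * k * (k C 3) + 2 * (k C 2) * (k C 2)))
    + m * (separations S + 2 * (k C 2) * (k * h * (k ∸ 2) + k * h * (k * h)))
blowUp {m} h z xs e₁ e₂ 3≤m P-gp lines halved refl {k} S S-gp 1≤k =
  G.config ,
  G.config-generalPosition (ℕ.≤-trans 3≤m (ℕ.m≤m*n m k {{>-nonZero 1≤k}})) ,
  G.separations-config h (Grid.halving xs h halved) (Grid.halving′ xs h halved) e₁ e₂
  where
  module G = Geometry (Grid.points xs) (Grid.partners xs) S P-gp S-gp 3≤m (Grid.lines-generic xs lines)

blowUp-base : ∀ {k} (S : Config k) → GeneralPosition S → 1 ≤ k →
  Σ (Config (75 * k)) λ Q → GeneralPosition Q × separations Q ≡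
    k * k * (k * k) * 6391680
    + 75 * 74 * (k * 73 * (2 * k * (k C 2)) + (2 * k * (k C 3) + 2 * (k C 2) * (k C 2)))
    + 75 * (separations S + 2 * (k C 2) * (k * 37 * (k ∸ 2) + k * 37 * (k * 37)))
blowUp-base = blowUp {75} {74} {73} 37 6391680 base refl refl (s≤s (s≤s (s≤s z≤n)))
  base-generalPosition base-lines base-balanced base-separations

-- 12038790 is D for m = 75: 24 · 450510 + 3 · 75 · 74 · 72 + 5 · 75 · 74. Here it arises as
-- 88738950 - 12 · 6391680, and 1800 is 24 · 75.
blowUp-crossings : ∀ {k} (S : Config k) → GeneralPosition S → (Q : Config (75 * k)) → GeneralPosition Q →
  separations Q ≡
    k * k * (k * k) * 6391680
    + 75 * 74 * (k * 73 * (2 * k * (k C 2)) + (2 * k * (k C 3) + 2 * (k C 2) * (k C 2)))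
    + 75 * (separations S + 2 * (k C 2) * (k * 37 * (k ∸ 2) + k * 37 * (k * 37))) →
  24 * crossings Q ≤ k * k * k * k * 12038790 + crossings S * 1800
blowUp-crossings {k} S S-gp Q Q-gp Q-separations = bound
  where
  g t d zˢ A q : ℕ
  g = k C 2
  t = k C 3
  d = k ∸ 2
  zˢ = separations S
  A = 75 * 74 * (k * 73 * (2 * k * g) + (2 * k * t + 2 * g * g)) + 75 * (2 * g * (k * 37 * d + k * 37 * (k * 37)))
  q = crossings Q
  split : 12 * separations Q ≡ k * k * k * k * 6391680 * 12 + 12 * A + 900 * zˢ
  split = trans (cong (12 *_) Q-separations)
    (lem k 6391680 zˢ (75 * 74 * (k * 73 * (2 * k * g) + (2 * k * t + 2 * g * g))) (2 * g * (k * 37 * d + k * 37 * (k * 37))))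
    where
    lem : ∀ k z zˢ x y → 12 * (k * k * (k * k) * z + x + 75 * (zˢ + y)) ≡ k * k * k * k * z * 12 + 12 * (x + 75 * y) + 900 * zˢ
    lem = solve-∀
  total : 24 * q + k * k * k * 1265400 + k * k * k * k * 6391680 * 12 ≡ k * k * k * k * 88738950 + k * k * 38850 + crossings S * 1800
  total = composite-sum k (crossings S) q zˢ 6391680 (separations Q) (k C 4) ((75 * k) C 4) A
    (crossings-separations S S-gp) (crossings-separations Q Q-gp) (24*nC4 k) (24*nC4 (75 * k)) split
    (composite-separations k g t d (2*nC2 k) (6*nC3 k) (nC2*[n∸2] k))
  bound : 24 * q ≤ k * k * k * k * 12038790 + crossings S * 1800
  bound = ℕ.+-cancelʳ-≤ (k * k * k * 1265400 + k * k * k * k * 76700160) _ _ (begin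
    24 * q + (k * k * k * 1265400 + k * k * k * k * 76700160)
      ≡⟨ lem₁ (24 * q) (k * k * k * 1265400) (k * k * k * k) ⟩
    24 * q + k * k * k * 1265400 + k * k * k * k * 6391680 * 12
      ≡⟨ total ⟩
    k * k * k * k * 88738950 + k * k * 38850 + crossings S * 1800
      ≤⟨ ℕ.+-monoˡ-≤ (crossings S * 1800) (ℕ.+-monoʳ-≤ (k * k * k * k * 88738950)
           (ℕ.*-mono-≤ (n²≤n³ k) (ℕ.≤ᵇ⇒≤ 38850 1265400 _))) ⟩
    k * k * k * k * 88738950 + k * k * k * 1265400 + crossings S * 1800
      ≡⟨ lem₂ (k * k * k * k) (k * k * k * 1265400) (crossings S * 1800) ⟩
    k * k * k * k * 12038790 + crossings S * 1800 + (k * k * k * 1265400 + k * k * k * k * 76700160) ∎)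
    where
    open ℕ.≤-Reasoning
    lem₁ : ∀ q c k⁴ → q + (c + k⁴ * 76700160) ≡ q + c + k⁴ * 6391680 * 12
    lem₁ = solve-∀
    lem₂ : ∀ k⁴ c s → k⁴ * 88738950 + c + s ≡ k⁴ * 12038790 + s + (c + k⁴ * 76700160)
    lem₂ = solve-∀

blowUp-bound : ∀ {k} (S : Config k) → GeneralPosition S → 1 ≤ k →
  Σ (Config (75 * k)) λ Q → GeneralPosition Q × 24 * crossings Q ≤ k * k * k * k * 12038790 + crossings S * 1800
blowUp-bound S S-gp 1≤k = proj₁ Q , proj₁ (proj₂ Q) , blowUp-crossings S S-gp (proj₁ Q) (proj₁ (proj₂ Q)) (proj₂ (proj₂ Q))
  where
  Q = blowUp-base S S-gp 1≤k

-- Estimates for rounding, and the induction on the number of points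

n≤n² : ∀ n → n ≤ n * n
n≤n² zero    = z≤n
n≤n² (suc n) = ℕ.m≤m*n (suc n) (suc n)

cube-mono-≤ : ∀ {m n} → m ≤ n → m * m * m ≤ n * n * n
cube-mono-≤ m≤n = ℕ.*-mono-≤ (ℕ.*-mono-≤ m≤n m≤n) m≤n

-- All lower powers in (74 + n)⁴ are raised to n³; their coefficients add up to 75⁴ - 1 = 31640624,
-- as n = 1 shows.
quartic-bound : ∀ x n → 1 ≤ n → x ≤ 74 + n → x * x * x * x ≤ n * n * n * n + n * n * n * 31640624
quartic-bound x n 1≤n x≤74+n = begin
  x * x * x * x
    ≤⟨ ℕ.*-mono-≤ (cube-mono-≤ x≤74+n) x≤74+n ⟩
  (74 + n) * (74 + n) * (74 + n) * (74 + n)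
    ≡⟨ lem₁ n ⟩
  n * n * n * n + (n * n * n * 296 + n * n * 32856 + n * 1620896 + 1 * 29986576)
    ≤⟨ ℕ.+-monoʳ-≤ (n * n * n * n) (ℕ.+-mono-≤ (ℕ.+-mono-≤ (ℕ.+-monoʳ-≤ (n * n * n * 296)
         (ℕ.*-monoˡ-≤ 32856 (n²≤n³ n))) (ℕ.*-monoˡ-≤ 1620896 n≤n³)) (ℕ.*-monoˡ-≤ 29986576 (ℕ.≤-trans 1≤n n≤n³))) ⟩
  n * n * n * n + (n * n * n * 296 + n * n * n * 32856 + n * n * n * 1620896 + n * n * n * 29986576)
    ≡⟨ lem₂ (n * n * n * n) (n * n * n) ⟩
  n * n * n * n + n * n * n * 31640624 ∎
  where
  open ℕ.≤-Reasoning
  n≤n³ : n ≤ n * n * n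
  n≤n³ = ℕ.≤-trans (n≤n² n) (n²≤n³ n)
  lem₁ : ∀ n → (74 + n) * (74 + n) * (74 + n) * (74 + n) ≡
    n * n * n * n + (n * n * n * 296 + n * n * 32856 + n * 1620896 + 1 * 29986576)
  lem₁ = solve-∀
  lem₂ : ∀ x y → x + (y * 296 + y * 32856 + y * 1620896 + y * 29986576) ≡ x + y * 31640624
  lem₂ = solve-∀

-- Amounts to 150 (k³ - 1) ≤ n³ - 1, with equality for k = n = 1. The factor 150 is twice the 75
-- copies of the cubic term.
cubic-bound : ∀ j k n → k ≡ j + 1 → j * 75 + 1 ≤ n → 150 * (k * k * k) + 1 ≤ n * n * n + 150
cubic-bound j k n refl 75j<n = begin
  150 * ((j + 1) * (j + 1) * (j + 1)) + 1
    ≡⟨ lem₁ j ⟩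
  j * j * j * 150 + j * j * 450 + (j * 225 + j * 225) + 151
    -- The cube of 75 j + 1 contains 16875 j² = 16650 j² + 225 j². The second part pays for one of
    -- the two terms 225 j.
    ≤⟨ ℕ.+-monoˡ-≤ 151 (ℕ.+-mono-≤ (ℕ.+-mono-≤ (ℕ.*-monoʳ-≤ (j * j * j) (ℕ.≤ᵇ⇒≤ 150 421875 _))
         (ℕ.*-monoʳ-≤ (j * j) (ℕ.≤ᵇ⇒≤ 450 16650 _))) (ℕ.+-monoʳ-≤ (j * 225) (ℕ.*-monoˡ-≤ 225 (n≤n² j)))) ⟩
  j * j * j * 421875 + j * j * 16650 + (j * 225 + j * j * 225) + 151
    ≡⟨ lem₂ j ⟩
  (j * 75 + 1) * (j * 75 + 1) * (j * 75 + 1) + 150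
    ≤⟨ ℕ.+-monoˡ-≤ 150 (cube-mono-≤ 75j<n) ⟩
  n * n * n + 150 ∎
  where
  open ℕ.≤-Reasoning
  lem₁ : ∀ j → 150 * ((j + 1) * (j + 1) * (j + 1)) + 1 ≡ j * j * j * 150 + j * j * 450 + (j * 225 + j * 225) + 151
  lem₁ = solve-∀
  lem₂ : ∀ j → j * j * j * 421875 + j * j * 16650 + (j * 225 + j * j * 225) + 151 ≡
    (j * 75 + 1) * (j * 75 + 1) * (j * 75 + 1) + 150
  lem₂ = solve-∀

-- The bound a n⁴ + 4γ (n³ - 1) on 24 b cr(n) is inherited by the blow-up: the
-- coefficient of n⁴ by the choice of the base set, and the excess of (75 k)⁴
-- over n⁴ is absorbed by 4γ n³, since 75 copies of the cubic term are small.
module Recursion (a b : ℕ) (base-bound : b * 12038790 + 75 * a ≤ a * 31640625) where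

  -- The numerator a times the constant 75⁴ - 1 of `quartic-bound`, so that one γ n³ covers the loss
  -- from rounding n up to a multiple of 75.
  γ : ℕ
  γ = a * 31640624

  Bounded : (n c : ℕ) → Set
  Bounded n c = b * (24 * c) + 4 * γ ≤ a * (n * n * n * n) + 4 * γ * (n * n * n)

  -- The four γ n³ are spent as follows: two on the 75 copies of 4γ k³, via `cubic`; one on
  -- rounding, via `quartic`; one on a remaining constant 2γ, via 2 ≤ n³. Adding 300γ = 75 · 4γ to
  -- both sides allows 75 copies of `c-bound` without subtraction.
  step : ∀ k n c q → 24 * q ≤ k * k * k * k * 12038790 + c * 1800 → Bounded k c →
    75 * k * (75 * k) * (75 * k) * (75 * k) ≤ n * n * n * n + n * n * n * 31640624 →
    150 * (k * k * k) + 1 ≤ n * n * n + 150 → 2 ≤ n * n * n → Bounded n q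
  step k n c q q-bound c-bound quartic cubic 2≤n³ = ℕ.+-cancelʳ-≤ (300 * γ) _ _ (begin
    b * (24 * q) + 4 * γ + 300 * γ
      ≤⟨ ℕ.+-monoˡ-≤ (300 * γ) (ℕ.+-monoˡ-≤ (4 * γ) (ℕ.*-monoʳ-≤ b q-bound)) ⟩
    b * (k⁴ * 12038790 + c * 1800) + 4 * γ + 300 * γ
      ≡⟨ lem₁ b k⁴ c γ ⟩
    k⁴ * (b * 12038790) + 75 * (b * (24 * c) + 4 * γ) + 4 * γ
      ≤⟨ ℕ.+-monoˡ-≤ (4 * γ) (ℕ.+-monoʳ-≤ (k⁴ * (b * 12038790)) (ℕ.*-monoʳ-≤ 75 c-bound)) ⟩
    k⁴ * (b * 12038790) + 75 * (a * k⁴ + 4 * γ * k³) + 4 * γ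
      ≡⟨ lem₂ a (b * 12038790) k⁴ γ k³ ⟩
    k⁴ * (b * 12038790 + 75 * a) + (2 * γ * (150 * k³ + 1) + 2 * γ)
      ≤⟨ ℕ.+-mono-≤ (ℕ.*-monoʳ-≤ k⁴ base-bound) (ℕ.+-monoˡ-≤ (2 * γ) (ℕ.*-monoʳ-≤ (2 * γ) cubic)) ⟩
    k⁴ * (a * 31640625) + (2 * γ * (n³ + 150) + 2 * γ)
      ≡⟨ cong (_+ (2 * γ * (n³ + 150) + 2 * γ)) (lem₃ a k) ⟩
    a * (75 * k * (75 * k) * (75 * k) * (75 * k)) + (2 * γ * (n³ + 150) + 2 * γ)
      ≤⟨ ℕ.+-mono-≤ (ℕ.*-monoʳ-≤ a quartic) (ℕ.+-monoʳ-≤ (2 * γ * (n³ + 150)) (ℕ.*-monoˡ-≤ γ 2≤n³)) ⟩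
    a * (n⁴ + n³ * 31640624) + (2 * γ * (n³ + 150) + n³ * γ)
      ≡⟨ lem₄ a n⁴ n³ ⟩
    a * n⁴ + 4 * γ * n³ + 300 * γ ∎)
    where
    open ℕ.≤-Reasoning
    k³ k⁴ n³ n⁴ : ℕ
    k³ = k * k * k
    k⁴ = k * k * k * k
    n³ = n * n * n
    n⁴ = n * n * n * n
    lem₁ : ∀ b k⁴ c γ → b * (k⁴ * 12038790 + c * 1800) + 4 * γ + 300 * γ ≡
      k⁴ * (b * 12038790) + 75 * (b * (24 * c) + 4 * γ) + 4 * γ
    lem₁ = solve-∀
    lem₂ : ∀ a b′ k⁴ γ k³ → k⁴ * b′ + 75 * (a * k⁴ + 4 * γ * k³) + 4 * γ ≡
      k⁴ * (b′ + 75 * a) + (2 * γ * (150 * k³ + 1) + 2 * γ)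
    lem₂ = solve-∀
    lem₃ : ∀ a k → k * k * k * k * (a * 31640625) ≡ a * (75 * k * (75 * k) * (75 * k) * (75 * k))
    lem₃ = solve-∀
    lem₄ : ∀ a n⁴ n³ → a * (n⁴ + n³ * 31640624) + (2 * (a * 31640624) * (n³ + 150) + n³ * (a * 31640624)) ≡
      a * n⁴ + 4 * (a * 31640624) * n³ + 300 * (a * 31640624)
    lem₄ = solve-∀

  Good : ℕ → Set
  Good n = Σ (Config n) λ P → GeneralPosition P × Bounded n (crossings P)

  good-one : Good 1
  good-one = P , ((λ { zero zero _ → refl }) , (λ { zero zero _ i≢j → ⊥-elim (i≢j refl) })) ,
    subst (Bounded 1) (sym (crossings≡sum₄ P)) (lem b a (4 * γ))
    where
    P : Config 1
    P _ = 0ℤ , 0ℤ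
    lem : ∀ b a δ → b * 0 + δ ≤ a * 1 + δ * 1
    lem b a δ rewrite ℕ.*-zeroʳ b | ℕ.*-identityʳ δ = ℕ.m≤n+m δ (a * 1)

  good-step : ∀ k n → 1 ≤ k → 2 ≤ n → n ≤ 75 * k → 75 * k ≤ 74 + n →
    150 * (k * k * k) + 1 ≤ n * n * n + 150 → Good k → Good n
  good-step k n 1≤k 2≤n n≤75k 75k≤74+n cubic (S , S-gp , S-bounded) = restricted (blowUp-bound S S-gp 1≤k)
    where
    restricted : (Σ (Config (75 * k)) λ Q → GeneralPosition Q × 24 * crossings Q ≤ k * k * k * k * 12038790 + crossings S * 1800) → Good n
    restricted (Q , Q-gp , Q-bound) =
      restrict n≤75k Q , restrict-generalPosition n≤75k Q Q-gp ,
      step k n (crossings S) (crossings (restrict n≤75k Q))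
        (ℕ.≤-trans (ℕ.*-monoʳ-≤ 24 (restrict-crossings n≤75k Q)) Q-bound) S-bounded
        (quartic-bound (75 * k) n (ℕ.<⇒≤ 2≤n) 75k≤74+n) cubic
        (ℕ.≤-trans 2≤n (ℕ.≤-trans (n≤n² n) (n²≤n³ n)))

  -- For n = m + 1 the set to blow up has ⌈n/75⌉ = 1 + ⌊m/75⌋ points. Strong induction on m works
  -- since ⌊m/75⌋ < m for m > 0.
  good : ∀ m → Good (suc m)
  good = <-rec (λ m → Good (suc m)) λ { zero _ → good-one ; (suc m) rec → good-suc m (rec (m/n<m (suc m) 75 (s≤s (s≤s z≤n)))) }
    where
    good-suc : ∀ m → Good (suc (suc m / 75)) → Good (suc (suc m))
    good-suc m = good-step (suc j) (suc (suc m)) (s≤s z≤n) (s≤s (s≤s z≤n)) n≤75k 75k≤74+n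
      (cubic-bound j (suc j) (suc (suc m)) (ℕ.+-comm 1 j) (subst (_≤ suc (suc m)) (ℕ.+-comm 1 (j * 75)) (s≤s 75j≤m)))
      where
      j : ℕ
      j = suc m / 75
      75j≤m : j * 75 ≤ suc m
      75j≤m = subst (j * 75 ≤_) (sym (m≡m%n+[m/n]*n (suc m) 75)) (ℕ.m≤n+m (j * 75) (suc m % 75))
      75k≤74+n : 75 * suc j ≤ 74 + suc (suc m)
      75k≤74+n = subst (_≤ 74 + suc (suc m)) (ℕ.*-comm (suc j) 75) (ℕ.+-monoʳ-≤ 75 75j≤m)
      n≤75k : suc (suc m) ≤ 75 * suc j
      n≤75k = subst (suc (suc m) ≤_) (ℕ.*-comm (suc j) 75)
        (subst (λ x → suc x ≤ 75 + j * 75) (sym (m≡m%n+[m/n]*n (suc m) 75)) (ℕ.+-monoˡ-≤ (j * 75) (m%n<n (suc m) 75)))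

  n⁴≤24*nC4+6n³ : ∀ n → n * n * n * n ≤ 24 * (n C 4) + 6 * (n * n * n)
  n⁴≤24*nC4+6n³ n = ℕ.+-cancelʳ-≤ (6 * n) _ _ (subst (n * n * n * n + 6 * n ≤_) (sym (24*nC4 n))
    (ℕ.+-monoʳ-≤ (n * n * n * n) (ℕ.*-mono-≤ {6} {11} (ℕ.≤ᵇ⇒≤ 6 11 _) (n≤n² n))))

  limit-bound : 1 ≤ b → qStar≤ a b
  -- The threshold makes b n⁴ exceed both cubic errors: s · 4γ n³ from `Bounded`, and 6 (a s + b) n³
  -- from replacing n⁴ by 24 C(n,4). The extra 1 excludes n = 0.
  limit-bound 1≤b M = suc (s * (4 * γ) + 6 * (a * s + b)) , λ { (suc m) N≤n → fromGood (suc m) (ℕ.<⇒≤ N≤n) (good m) }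
    where
    s : ℕ
    s = suc M
    fromGood : ∀ n → s * (4 * γ) + 6 * (a * s + b) ≤ n → Good n →
      Σ ℕ (λ c → crBar≤ n c × c * b * s ≤ (a * s + b) * (n C 4))
    fromGood n N≤n (P , P-gp , P-bounded) =
      crossings P , (P , P-gp , ℕ.≤-refl) , ℕ.*-cancelˡ-≤ 24 (ℕ.+-cancelʳ-≤ (6 * (a * s + b) * n³) _ _ (begin
        24 * (crossings P * b * s) + 6 * (a * s + b) * n³
          ≡⟨ lem₁ (crossings P) b s (6 * (a * s + b) * n³) ⟩
        s * (b * (24 * crossings P)) + 6 * (a * s + b) * n³
          ≤⟨ ℕ.+-monoˡ-≤ (6 * (a * s + b) * n³) (ℕ.*-monoʳ-≤ s (ℕ.≤-trans (ℕ.m≤m+n _ (4 * γ)) P-bounded)) ⟩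
        s * (a * n⁴ + 4 * γ * n³) + 6 * (a * s + b) * n³
          ≡⟨ lem₂ s a n⁴ (4 * γ) n³ (6 * (a * s + b)) ⟩
        a * s * n⁴ + (s * (4 * γ) + 6 * (a * s + b)) * n³
          ≤⟨ ℕ.+-monoʳ-≤ (a * s * n⁴) (ℕ.*-monoˡ-≤ n³ (ℕ.≤-trans N≤n (ℕ.m≤n*m n b {{>-nonZero 1≤b}}))) ⟩
        a * s * n⁴ + b * n * n³
          ≡⟨ lem₃ a s b n ⟩
        (a * s + b) * n⁴
          ≤⟨ ℕ.*-monoʳ-≤ (a * s + b) (n⁴≤24*nC4+6n³ n) ⟩
        (a * s + b) * (24 * (n C 4) + 6 * n³)
          ≡⟨ lem₄ (a * s + b) (n C 4) n³ ⟩
        24 * ((a * s + b) * (n C 4)) + 6 * (a * s + b) * n³ ∎))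
      where
      open ℕ.≤-Reasoning
      n³ n⁴ : ℕ
      n³ = n * n * n
      n⁴ = n * n * n * n
      lem₁ : ∀ c b s x → 24 * (c * b * s) + x ≡ s * (b * (24 * c)) + x
      lem₁ = solve-∀
      lem₂ : ∀ s a n⁴ δ n³ y → s * (a * n⁴ + δ * n³) + y * n³ ≡ a * s * n⁴ + (s * δ + y) * n³
      lem₂ = solve-∀
      lem₃ : ∀ a s b n → a * s * (n * n * n * n) + b * n * (n * n * n) ≡ (a * s + b) * (n * n * n * n)
      lem₃ = solve-∀
      lem₄ : ∀ x c n³ → x * (24 * c + 6 * n³) ≡ 24 * (x * c) + 6 * x * n³
      lem₄ = solve-∀

theorem4 : qStar≤ 83247328 218791125 × (83247328 * 1000000 < 380488 * 218791125)
-- The first numerical check is D / (75⁴ - 75) ≤ a / b with denominators cleared; the left side is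
-- about 0.380486 and the right side about 0.3804877.
theorem4 = Recursion.limit-bound 83247328 218791125 (ℕ.≤ᵇ⇒≤ _ _ _) (s≤s z≤n) , ℕ.<ᵇ⇒< _ _ _
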